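{- Let $n\ge 3$ be an integer and let $C_n$ denote the cycle on $n$ vertices. For any $x\in\mathbb{N}$ and any integer $y$ with $0\le y\le x$, \[ P(C_n,x,y) = \left( \frac{x - 1 - \sqrt{(x+1)^2-4y} }{2} \right)^{n} + \left( \frac{x - 1 + \sqrt{(x+1)^2-4y}}{2} \right)^{n} + (-1)^{n} (y - 1). \]
   Context: For a finite simple graph $G=(V,E)$, $x\in\mathbb{N}$ and $y\in\{0,\dots,x\}$, the bivariate chromatic polynomial $P(G,x,y)$ is the number of maps $f:V\to\{1,\dots,x\}$ such that for every edge $\{v,w\}\in E$, either $f(v)\neq f(w)$ or $f(v)=f(w)>y$. (Equivalently: colorings in which adjacent vertices receive different colors or share a color from $\{y+1,\dots,x\}$.) -}

module Defs where

open import Data.Fin.Base using (Fin; toℕ; finToFun)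
import Data.Fin.Properties as Fin
open import Data.Integer.Base as ℤ using (ℤ; +_; -[1+_])
import Data.Integer.Properties as ℤ
open import Data.Integer.Solver renaming (module +-*-Solver to ℤ-Solver)
open import Data.List.Base using (length; filter; allFin)
open import Data.Nat.Base as ℕ using (ℕ; zero; suc)
import Data.Nat.Properties as ℕ
open import Data.Product.Base using (Σ-syntax; ∃-syntax; _×_; _,_; proj₁; proj₂)
open import Data.Rational.Base as ℚ using (ℚ; 0ℚ; 1ℚ; ½; ∣_∣; mkℚ)
import Data.Rational.Properties as ℚ
open import Data.Rational.Solver renaming (module +-*-Solver to ℚ-Solver)
import Data.Rational.Unnormalised.Base as ℚᵘ
import Data.Rational.Unnormalised.Properties as ℚᵘ
open import Data.Sum.Base as Sum using (_⊎_; inj₁; inj₂)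
open import Relation.Binary.PropositionalEquality
open import Relation.Nullary using (¬_; Dec; yes; no; contradiction)
open import Relation.Nullary.Decidable using (_×-dec_; _⊎-dec_; _→-dec_; ¬?)

record Graph (n : ℕ) : Set₁ where
  field
    Adj    : Fin n → Fin n → Set
    adj?   : ∀ v w → Dec (Adj v w)
    symm   : ∀ {v w} → Adj v w → Adj w v
    irrefl : ∀ {v} → ¬ Adj v v

open Graph

-- The colours 1, …, x are the elements of Fin x, shifted by one.
colour : ∀ {x} → Fin x → ℕ
colour c = suc (toℕ c)

Admissible : ∀ {n} → Graph n → (x y : ℕ) → (Fin n → Fin x) → Set
Admissible G x y f =
  ∀ v w → Adj G v w → f v ≢ f w ⊎ (f v ≡ f w × y ℕ.< colour (f v))

admissible? : ∀ {n} (G : Graph n) x y f → Dec (Admissible G x y f)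
admissible? G x y f = Fin.all? λ v → Fin.all? λ w →
  adj? G v w →-dec
    (¬? (f v Fin.≟ f w) ⊎-dec ((f v Fin.≟ f w) ×-dec (y ℕ.<? colour (f v))))

-- finToFun is a bijection from Fin (x ^ n) onto the maps Fin n → Fin x
-- (up to pointwise equality), so this counts every map exactly once.
P : ∀ {n} → Graph n → (x y : ℕ) → ℕ
P {n} G x y =
  length (filter (λ k → admissible? G x y (finToFun k)) (allFin (x ℕ.^ n)))

Next : ∀ {n} → Fin n → Fin n → Set
Next {n} v w = toℕ w ≡ suc (toℕ v) ⊎ (suc (toℕ v) ≡ n × toℕ w ≡ 0)

next? : ∀ {n} (v w : Fin n) → Dec (Next v w)
next? {n} v w =
  (toℕ w ℕ.≟ suc (toℕ v)) ⊎-dec ((suc (toℕ v) ℕ.≟ n) ×-dec (toℕ w ℕ.≟ 0))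

next-irrefl : ∀ {n} → 3 ℕ.≤ n → {v : Fin n} → ¬ Next v v
next-irrefl _   (inj₁ v≡1+v)          = ℕ.1+n≢n (sym v≡1+v)
next-irrefl 3≤n (inj₂ (1+v≡n , v≡0)) =
  contradiction (subst (3 ℕ.≤_) (trans (sym 1+v≡n) (cong suc v≡0)) 3≤n)
    λ { (ℕ.s≤s ()) }

C : ∀ n → 3 ℕ.≤ n → Graph n
C n 3≤n = record
  { Adj    = λ v w → Next v w ⊎ Next w v
  ; adj?   = λ v w → next? v w ⊎-dec next? w v
  ; symm   = Sum.swap
  ; irrefl = Sum.[ next-irrefl 3≤n , next-irrefl 3≤n ]
  }

private
  cross : ∀ k d → (+ 1 ℤ.+ k) ℤ.* (d ℤ.* d) ≡ (k ℤ.* d ℤ.+ + 1 ℤ.* d) ℤ.* d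
  cross = solve 2 (λ k d → (con (+ 1) :+ k) :* (d :* d)
                             := (k :* d :+ con (+ 1) :* d) :* d) refl
    where open ℤ-Solver

module Rational where
  open import Data.Rational.Base hiding (module ℚ; ℚ; 0ℚ; 1ℚ; ½; ∣_∣; mkℚ)
  open ℚ.≤-Reasoning
  open ℚ-Solver

  ∣-∣≤-intro : ∀ {p q ε} → p ≤ q + ε → q ≤ p + ε → ∣ p - q ∣ ≤ ε
  ∣-∣≤-intro {p} {q} {ε} p≤ q≤ with ℚ.∣p∣≡p∨∣p∣≡-p (p - q)
  ... | inj₁ eq = begin
    ∣ p - q ∣      ≡⟨ eq ⟩
    p - q          ≤⟨ ℚ.+-monoˡ-≤ (- q) p≤ ⟩
    q + ε - q      ≡⟨ solve 2 (λ q ε → q :+ ε :- q := ε) refl q ε ⟩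
    ε              ∎
  ... | inj₂ eq = begin
    ∣ p - q ∣      ≡⟨ eq ⟩
    - (p - q)      ≡⟨ solve 2 (λ p q → :- (p :- q) := q :- p) refl p q ⟩
    q - p          ≤⟨ ℚ.+-monoˡ-≤ (- p) q≤ ⟩
    p + ε - p      ≡⟨ solve 2 (λ q ε → q :+ ε :- q := ε) refl p ε ⟩
    ε              ∎

  p≤∣p∣ : ∀ p → p ≤ ∣ p ∣
  p≤∣p∣ p with ℚ.≤-total 0ℚ p
  ... | inj₁ 0≤p = ℚ.≤-reflexive (sym (ℚ.0≤p⇒∣p∣≡p 0≤p))
  ... | inj₂ p≤0 = ℚ.≤-trans p≤0 (ℚ.0≤∣p∣ p)

  ∣-∣≤-elimˡ : ∀ {p q ε} → ∣ p - q ∣ ≤ ε → p ≤ q + ε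
  ∣-∣≤-elimˡ {p} {q} {ε} h = begin
    p              ≡⟨ solve 2 (λ p q → p := q :+ (p :- q)) refl p q ⟩
    q + (p - q)    ≤⟨ ℚ.+-monoʳ-≤ q (ℚ.≤-trans (p≤∣p∣ (p - q)) h) ⟩
    q + ε          ∎

  ∣p-q∣≡∣q-p∣ : ∀ p q → ∣ p - q ∣ ≡ ∣ q - p ∣
  ∣p-q∣≡∣q-p∣ p q = trans (sym (ℚ.∣-p∣≡∣p∣ (p - q)))
    (cong ∣_∣ (solve 2 (λ p q → :- (p :- q) := q :- p) refl p q))

  ∣-∣≤-elimʳ : ∀ {p q ε} → ∣ p - q ∣ ≤ ε → q ≤ p + ε
  ∣-∣≤-elimʳ {p} {q} {ε} h =
    ∣-∣≤-elimˡ (subst (_≤ ε) (∣p-q∣≡∣q-p∣ p q) h)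

  p+½ε+½ε : ∀ ε → ½ * ε + ½ * ε ≡ ε
  p+½ε+½ε ε = trans (sym (ℚ.*-distribʳ-+ ε ½ ½)) (ℚ.*-identityˡ ε)

  0<½* : ∀ {ε} → 0ℚ < ε → 0ℚ < ½ * ε
  0<½* {ε} 0<ε = subst (_< ½ * ε) (ℚ.*-zeroʳ ½) (ℚ.*-monoʳ-<-pos ½ 0<ε)

  0<* : ∀ {p q} → 0ℚ < p → 0ℚ < q → 0ℚ < p * q
  0<* {p} {q} 0<p 0<q =
    subst (_< p * q) (ℚ.*-zeroʳ p) (ℚ.*-monoʳ-<-pos p {{positive 0<p}} 0<q)

  0≤* : ∀ {p q} → 0ℚ ≤ p → 0ℚ ≤ q → 0ℚ ≤ p * q
  0≤* {p} {q} 0≤p 0≤q =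
    subst (_≤ p * q) (ℚ.*-zeroʳ p) (ℚ.*-monoˡ-≤-nonNeg p {{nonNegative 0≤p}} 0≤q)

  0≤+ : ∀ {p q} → 0ℚ ≤ p → 0ℚ ≤ q → 0ℚ ≤ p + q
  0≤+ 0≤p 0≤q = ℚ.+-mono-≤ 0≤p 0≤q

  *-mono-≤-nonNeg : ∀ {p q r s} → 0ℚ ≤ r → 0ℚ ≤ q →
                    p ≤ q → r ≤ s → p * r ≤ q * s
  *-mono-≤-nonNeg {p} {q} {r} {s} 0≤r 0≤q p≤q r≤s = ℚ.≤-trans
    (ℚ.*-monoʳ-≤-nonNeg r {{nonNegative 0≤r}} p≤q)
    (ℚ.*-monoˡ-≤-nonNeg q {{nonNegative 0≤q}} r≤s)

  sq-cancel-≤ : ∀ {u v} → 0ℚ ≤ v → u * u ≤ v * v → u ≤ v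
  sq-cancel-≤ {u} {v} 0≤v uu≤vv = ℚ.≮⇒≥ λ v<u →
    ℚ.<-irrefl refl (begin-strict
      v * v  ≤⟨ ℚ.*-monoˡ-≤-nonNeg v {{nonNegative 0≤v}} (ℚ.<⇒≤ v<u) ⟩
      v * u  <⟨ ℚ.*-monoˡ-<-pos u {{positive (ℚ.≤-<-trans 0≤v v<u)}} v<u ⟩
      u * u  ≤⟨ uu≤vv ⟩
      v * v  ∎)

  toℚᵘ-/ : ∀ i n → toℚᵘ (i / suc n) ℚᵘ.≃ ℚᵘ.mkℚᵘ i n
  toℚᵘ-/ i n = ℚ.toℚᵘ-fromℚᵘ (ℚᵘ.mkℚᵘ i n)

  /-mono : ∀ {i j m n} → i ℤ.* + suc n ℤ.≤ j ℤ.* + suc m →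
           i / suc m ≤ j / suc n
  /-mono {i} {j} {m} {n} h = ℚ.toℚᵘ-cancel-≤
    (ℚᵘ.≤-respˡ-≃ (ℚᵘ.≃-sym (toℚᵘ-/ i m))
    (ℚᵘ.≤-respʳ-≃ (ℚᵘ.≃-sym (toℚᵘ-/ j n)) (ℚᵘ.*≤* h)))

  suc/ : ∀ k n → + suc k / suc n ≡ + k / suc n + + 1 / suc n
  suc/ k n = ℚ.toℚᵘ-injective
    (ℚᵘ.≃-trans (toℚᵘ-/ (+ suc k) n)
    (ℚᵘ.≃-trans (ℚᵘ.*≡* (cross (+ k) (+ suc n)))
    (ℚᵘ.≃-sym (ℚᵘ.≃-trans (ℚ.toℚᵘ-homo-+ (+ k / suc n) (+ 1 / suc n))
                          (ℚᵘ.+-cong (toℚᵘ-/ (+ k) n) (toℚᵘ-/ (+ 1) n))))))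

  0≤/ : ∀ k n → 0ℚ ≤ + k / suc n
  0≤/ k n = /-mono {+ 0} {+ k} {0} {n} (subst (+ 0 ℤ.≤_) (sym (ℤ.*-identityʳ (+ k))) (ℤ.+≤+ ℕ.z≤n))

  0<1/ : ∀ n → 0ℚ < + 1 / suc n
  0<1/ n = ℚ.positive⁻¹ (+ 1 / suc n) {{ℚ.normalize-pos 1 (suc n)}}

  archimedean : ∀ ε → 0ℚ < ε →
                ∃[ N ] (∀ n → N ℕ.≤ n → + 1 / suc n ≤ ε)
  archimedean ε@(mkℚ (+ zero) d c) 0<ε = contradiction (positive 0<ε) λ ()
  archimedean ε@(mkℚ -[1+ _ ] d c) 0<ε = contradiction (positive 0<ε) λ ()
  archimedean ε@(mkℚ (+ suc p) d c) 0<ε = d , λ n d≤n →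
    ℚ.≤-trans
      (/-mono {+ 1} {+ suc p} {n} {d}
        (ℤ.+≤+ (ℕ.*-mono-≤ {1} {suc p} (ℕ.s≤s ℕ.z≤n) (ℕ.s≤s d≤n))))
      (ℚ.≤-reflexive (ℚ.↥p/↧p≡p ε))

open Rational

IsCauchy : (ℕ → ℚ) → Set
IsCauchy s = ∀ ε → 0ℚ ℚ.< ε →
  ∃[ N ] (∀ m n → N ℕ.≤ m → N ℕ.≤ n → ∣ s m ℚ.- s n ∣ ℚ.≤ ε)

-- A real number is a Cauchy sequence of rationals; equality of real numbers
-- is the relation _≃_ below, not _≡_.
record ℝ : Set where
  constructor mkℝ
  field
    seq    : ℕ → ℚ
    cauchy : IsCauchy seq

open ℝ public

infix  4 _≃_ _≤_
infixl 6 _+_ _-_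
infixl 7 _*_ _/_
infix  8 -_
infixr 8 _^_

_≃_ : ℝ → ℝ → Set
a ≃ b = ∀ ε → 0ℚ ℚ.< ε →
  ∃[ N ] (∀ n → N ℕ.≤ n → ∣ seq a n ℚ.- seq b n ∣ ℚ.≤ ε)

_≤_ : ℝ → ℝ → Set
a ≤ b = ∀ ε → 0ℚ ℚ.< ε →
  ∃[ N ] (∀ n → N ℕ.≤ n → seq a n ℚ.≤ seq b n ℚ.+ ε)

fromℚ : ℚ → ℝ
fromℚ q = mkℝ (λ _ → q) λ ε 0<ε → 0 , λ _ _ _ _ →
  subst (λ p → ∣ p ∣ ℚ.≤ ε) (sym (ℚ.+-inverseʳ q)) (ℚ.<⇒≤ 0<ε)

fromℕ : ℕ → ℝ
fromℕ n = fromℚ (+ n ℚ./ 1)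

0ℝ 1ℝ : ℝ
0ℝ = fromℚ 0ℚ
1ℝ = fromℚ 1ℚ

_+_ : ℝ → ℝ → ℝ
mkℝ a ca + mkℝ b cb = mkℝ (λ n → a n ℚ.+ b n) cauchy-+
  where
  cauchy-+ : IsCauchy (λ n → a n ℚ.+ b n)
  cauchy-+ ε 0<ε with ca (½ ℚ.* ε) (0<½* 0<ε) | cb (½ ℚ.* ε) (0<½* 0<ε)
  ... | N , hN | M , hM = N ℕ.⊔ M , λ m n m≥ n≥ → begin
    ∣ (a m ℚ.+ b m) ℚ.- (a n ℚ.+ b n) ∣
      ≡⟨ cong ∣_∣ (solve 4 (λ p q r s → (p :+ q) :- (r :+ s) := (p :- r) :+ (q :- s))
                     refl (a m) (b m) (a n) (b n)) ⟩
    ∣ (a m ℚ.- a n) ℚ.+ (b m ℚ.- b n) ∣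
      ≤⟨ ℚ.∣p+q∣≤∣p∣+∣q∣ (a m ℚ.- a n) (b m ℚ.- b n) ⟩
    ∣ a m ℚ.- a n ∣ ℚ.+ ∣ b m ℚ.- b n ∣
      ≤⟨ ℚ.+-mono-≤ (hN m n (ℕ.m⊔n≤o⇒m≤o N M m≥) (ℕ.m⊔n≤o⇒m≤o N M n≥))
                    (hM m n (ℕ.m⊔n≤o⇒n≤o N M m≥) (ℕ.m⊔n≤o⇒n≤o N M n≥)) ⟩
    ½ ℚ.* ε ℚ.+ ½ ℚ.* ε
      ≡⟨ p+½ε+½ε ε ⟩
    ε ∎
    where open ℚ.≤-Reasoning
          open ℚ-Solver

-_ : ℝ → ℝ
- mkℝ a ca = mkℝ (λ n → ℚ.- a n) λ ε 0<ε →
  let N , hN = ca ε 0<ε in N , λ m n m≥ n≥ →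
  subst (ℚ._≤ ε)
    (trans (sym (ℚ.∣-p∣≡∣p∣ (a m ℚ.- a n)))
           (cong ∣_∣ (ℚ.neg-distrib-+ (a m) (ℚ.- a n))))
    (hN m n m≥ n≥)

_-_ : ℝ → ℝ → ℝ
a - b = a + (- b)

bounded : ∀ {s} → IsCauchy s →
          Σ[ B ∈ ℚ ] (0ℚ ℚ.< B × ∃[ N ] (∀ n → N ℕ.≤ n → ∣ s n ∣ ℚ.≤ B))
bounded {s} cs with cs 1ℚ (ℚ.positive⁻¹ 1ℚ)
... | N , hN = ∣ s N ∣ ℚ.+ 1ℚ
             , ℚ.+-mono-≤-< (ℚ.0≤∣p∣ (s N)) (ℚ.positive⁻¹ 1ℚ)
             , N , λ n n≥ → begin
  ∣ s n ∣                        ≡⟨ cong ∣_∣ (solve 2 (λ p q → p := q :+ (p :- q)) refl (s n) (s N)) ⟩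
  ∣ s N ℚ.+ (s n ℚ.- s N) ∣      ≤⟨ ℚ.∣p+q∣≤∣p∣+∣q∣ (s N) (s n ℚ.- s N) ⟩
  ∣ s N ∣ ℚ.+ ∣ s n ℚ.- s N ∣    ≤⟨ ℚ.+-monoʳ-≤ ∣ s N ∣ (hN n N n≥ ℕ.≤-refl) ⟩
  ∣ s N ∣ ℚ.+ 1ℚ                 ∎
  where open ℚ.≤-Reasoning
        open ℚ-Solver

-- For B, ε > 0 a δ > 0 with B δ = ε.
divide : ∀ B ε → 0ℚ ℚ.< B → 0ℚ ℚ.< ε → Σ[ δ ∈ ℚ ] (0ℚ ℚ.< δ × B ℚ.* δ ≡ ε)
divide B ε 0<B 0<ε = B⁻¹ ℚ.* ε , 0<* 0<B⁻¹ 0<ε , (begin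
  B ℚ.* (B⁻¹ ℚ.* ε)  ≡⟨ ℚ.*-assoc B B⁻¹ ε ⟨
  B ℚ.* B⁻¹ ℚ.* ε    ≡⟨ cong (ℚ._* ε) (ℚ.*-inverseʳ B) ⟩
  1ℚ ℚ.* ε           ≡⟨ ℚ.*-identityˡ ε ⟩
  ε                  ∎)
  where
  open ≡-Reasoning
  instance
    B-pos : ℚ.Positive B
    B-pos = ℚ.positive 0<B
    B-nz : ℚ.NonZero B
    B-nz = ℚ.pos⇒nonZero B
  B⁻¹ = ℚ.1/ B
  0<B⁻¹ : 0ℚ ℚ.< B⁻¹
  0<B⁻¹ = ℚ.positive⁻¹ B⁻¹ {{ℚ.1/pos⇒pos B}}

_*_ : ℝ → ℝ → ℝ
mkℝ a ca * mkℝ b cb = mkℝ (λ n → a n ℚ.* b n) cauchy-*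
  where
  cauchy-* : IsCauchy (λ n → a n ℚ.* b n)
  cauchy-* ε 0<ε =
    let
      A , 0<A , K , hK = bounded {a} ca
      B , 0<B , L , hL = bounded {b} cb
      δ , 0<δ , eq     = divide (A ℚ.+ B) ε (ℚ.+-mono-< 0<A 0<B) 0<ε
      N , hN           = ca δ 0<δ
      M , hM           = cb δ 0<δ
    in (K ℕ.⊔ L) ℕ.⊔ (N ℕ.⊔ M) , λ m n m≥ n≥ →
    let
      m≥KL = ℕ.m⊔n≤o⇒m≤o (K ℕ.⊔ L) (N ℕ.⊔ M) m≥
      n≥KL = ℕ.m⊔n≤o⇒m≤o (K ℕ.⊔ L) (N ℕ.⊔ M) n≥
      m≥NM = ℕ.m⊔n≤o⇒n≤o (K ℕ.⊔ L) (N ℕ.⊔ M) m≥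
      n≥NM = ℕ.m⊔n≤o⇒n≤o (K ℕ.⊔ L) (N ℕ.⊔ M) n≥
    in begin
    ∣ a m ℚ.* b m ℚ.- a n ℚ.* b n ∣
      ≡⟨ cong ∣_∣ (solve 4 (λ p q r s → p :* q :- r :* s := p :* (q :- s) :+ s :* (p :- r))
                     refl (a m) (b m) (a n) (b n)) ⟩
    ∣ a m ℚ.* (b m ℚ.- b n) ℚ.+ b n ℚ.* (a m ℚ.- a n) ∣
      ≤⟨ ℚ.∣p+q∣≤∣p∣+∣q∣ (a m ℚ.* (b m ℚ.- b n)) (b n ℚ.* (a m ℚ.- a n)) ⟩
    ∣ a m ℚ.* (b m ℚ.- b n) ∣ ℚ.+ ∣ b n ℚ.* (a m ℚ.- a n) ∣
      ≡⟨ cong₂ ℚ._+_ (ℚ.∣p*q∣≡∣p∣*∣q∣ (a m) (b m ℚ.- b n)) (ℚ.∣p*q∣≡∣p∣*∣q∣ (b n) (a m ℚ.- a n)) ⟩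
    ∣ a m ∣ ℚ.* ∣ b m ℚ.- b n ∣ ℚ.+ ∣ b n ∣ ℚ.* ∣ a m ℚ.- a n ∣
      ≤⟨ ℚ.+-mono-≤
           (*-mono-≤-nonNeg {∣ a m ∣} {A} {∣ b m ℚ.- b n ∣} {δ} (ℚ.0≤∣p∣ (b m ℚ.- b n)) (ℚ.<⇒≤ 0<A)
             (hK m (ℕ.m⊔n≤o⇒m≤o K L m≥KL))
             (hM m n (ℕ.m⊔n≤o⇒n≤o N M m≥NM) (ℕ.m⊔n≤o⇒n≤o N M n≥NM)))
           (*-mono-≤-nonNeg {∣ b n ∣} {B} {∣ a m ℚ.- a n ∣} {δ} (ℚ.0≤∣p∣ (a m ℚ.- a n)) (ℚ.<⇒≤ 0<B)
             (hL n (ℕ.m⊔n≤o⇒n≤o K L n≥KL))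
             (hN m n (ℕ.m⊔n≤o⇒m≤o N M m≥NM) (ℕ.m⊔n≤o⇒m≤o N M n≥NM))) ⟩
    A ℚ.* δ ℚ.+ B ℚ.* δ
      ≡⟨ ℚ.*-distribʳ-+ δ A B ⟨
    (A ℚ.+ B) ℚ.* δ
      ≡⟨ eq ⟩
    ε ∎
    where open ℚ.≤-Reasoning
          open ℚ-Solver

_/_ : ℝ → (d : ℕ) → .{{ℕ.NonZero d}} → ℝ
a / d = a * fromℚ (+ 1 ℚ./ d)

_^_ : ℝ → ℕ → ℝ
a ^ zero  = 1ℝ
a ^ suc n = a * a ^ n

module _ {Q : ℕ → Set} (Q? : ∀ k → Dec (Q k)) where

  -- The greatest i ≤ k with Q i, or 0 if there is none.
  greatest≤ : ℕ → ℕ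
  greatest≤ zero    = zero
  greatest≤ (suc k) with Q? (suc k)
  ... | yes _ = suc k
  ... | no  _ = greatest≤ k

  greatest≤-holds : Q 0 → ∀ k → Q (greatest≤ k)
  greatest≤-holds q₀ zero    = q₀
  greatest≤-holds q₀ (suc k) with Q? (suc k)
  ... | yes q = q
  ... | no  _ = greatest≤-holds q₀ k

  greatest≤-maximal : ∀ k → ¬ Q (suc k) → ¬ Q (suc (greatest≤ k))
  greatest≤-maximal zero    ¬q = ¬q
  greatest≤-maximal (suc k) ¬q with Q? (suc k)
  ... | yes _  = ¬q
  ... | no ¬q′ = greatest≤-maximal k ¬q′

-- For q ≥ 0, √-approx q n is the greatest multiple of 1/(n+1) whose square
-- is at most q.
module _ (q : ℚ) (n : ℕ) where

  private
    Below : ℕ → Set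
    Below k = (+ k ℚ./ suc n) ℚ.* (+ k ℚ./ suc n) ℚ.≤ q

    below? : ∀ k → Dec (Below k)
    below? k = (+ k ℚ./ suc n) ℚ.* (+ k ℚ./ suc n) ℚ.≤? q

    bound : ℕ
    bound = suc n ℕ.* suc ℤ.∣ ℚ.↥ q ∣

  √-approx : ℚ
  √-approx = + greatest≤ below? bound ℚ./ suc n

  private
    q<bound² : ¬ Below (suc bound)
    q<bound² b = ℚ.<-irrefl refl (ℚ.<-≤-trans q<g (ℚ.≤-trans g≤gg b))
      where
      g = + suc bound ℚ./ suc n
      B = suc ℤ.∣ ℚ.↥ q ∣

      B≤g : + B ℚ./ 1 ℚ.≤ g
      B≤g = /-mono {+ B} {+ suc bound} {0} {n} (ℤ.+≤+ (begin
        B ℕ.* suc n       ≡⟨ ℕ.*-comm B (suc n) ⟩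
        bound             ≤⟨ ℕ.n≤1+n bound ⟩
        suc bound         ≡⟨ ℕ.*-identityʳ (suc bound) ⟨
        suc bound ℕ.* 1   ∎))
        where open ℕ.≤-Reasoning

      q≤↥q : ∀ p → p ℚ.≤ + ℤ.∣ ℚ.↥ p ∣ ℚ./ 1
      q≤↥q p@(mkℚ i d _) = subst (ℚ._≤ + ℤ.∣ i ∣ ℚ./ 1) (ℚ.↥p/↧p≡p p)
        (/-mono {i} {+ ℤ.∣ i ∣} {d} {0} (begin
          i ℤ.* + 1               ≡⟨ ℤ.*-identityʳ i ⟩
          i                       ≤⟨ i≤∣i∣ i ⟩
          + ℤ.∣ i ∣               ≤⟨ ℤ.+≤+ (ℕ.m≤m*n ℤ.∣ i ∣ (suc d)) ⟩
          + (ℤ.∣ i ∣ ℕ.* suc d)   ≡⟨ ℤ.pos-* ℤ.∣ i ∣ (suc d) ⟩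
          + ℤ.∣ i ∣ ℤ.* + suc d   ∎))
        where
        open ℤ.≤-Reasoning
        i≤∣i∣ : ∀ i → i ℤ.≤ + ℤ.∣ i ∣
        i≤∣i∣ (+ _)    = ℤ.≤-refl
        i≤∣i∣ -[1+ _ ] = ℤ.-≤+

      q<g : q ℚ.< g
      q<g = begin-strict
        q                            ≤⟨ q≤↥q q ⟩
        + ℤ.∣ ℚ.↥ q ∣ ℚ./ 1          ≡⟨ ℚ.+-identityʳ _ ⟨
        + ℤ.∣ ℚ.↥ q ∣ ℚ./ 1 ℚ.+ 0ℚ   <⟨ ℚ.+-monoʳ-< (+ ℤ.∣ ℚ.↥ q ∣ ℚ./ 1) (0<1/ 0) ⟩
        + ℤ.∣ ℚ.↥ q ∣ ℚ./ 1 ℚ.+ 1ℚ   ≡⟨ suc/ ℤ.∣ ℚ.↥ q ∣ 0 ⟨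
        + B ℚ./ 1                    ≤⟨ B≤g ⟩
        g                            ∎
        where open ℚ.≤-Reasoning

      g≤gg : g ℚ.≤ g ℚ.* g
      g≤gg = subst (ℚ._≤ g ℚ.* g) (ℚ.*-identityʳ g)
        (ℚ.*-monoˡ-≤-nonNeg g {{ℚ.nonNegative (0≤/ (suc bound) n)}}
          (ℚ.≤-trans (/-mono {+ 1} {+ B} {0} {0} (ℤ.+≤+ (ℕ.s≤s ℕ.z≤n))) B≤g))

    q≤suc-greatest² : q ℚ.< (√-approx ℚ.+ + 1 ℚ./ suc n) ℚ.* (√-approx ℚ.+ + 1 ℚ./ suc n)
    q≤suc-greatest² = subst (λ r → q ℚ.< r ℚ.* r) (suc/ (greatest≤ below? bound) n)
      (ℚ.≰⇒> (greatest≤-maximal below? bound q<bound²))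

  √-approx-nonNeg : 0ℚ ℚ.≤ √-approx
  √-approx-nonNeg = 0≤/ (greatest≤ below? bound) n

  √-approx-lower : 0ℚ ℚ.≤ q → √-approx ℚ.* √-approx ℚ.≤ q
  √-approx-lower 0≤q = greatest≤-holds below? below0 bound
    where
    below0 : Below 0
    below0 = subst (λ z → z ℚ.* z ℚ.≤ q) (sym (ℚ.0/n≡0 (suc n))) 0≤q

  √-approx-upper : q ℚ.≤ (√-approx ℚ.+ + 1 ℚ./ suc n) ℚ.* (√-approx ℚ.+ + 1 ℚ./ suc n)
  √-approx-upper = ℚ.<⇒≤ q≤suc-greatest²

private
  √-step : ∀ {p q s t δ ε} → 0ℚ ℚ.≤ t → 0ℚ ℚ.≤ δ → 0ℚ ℚ.≤ ε →
    s ℚ.* s ℚ.≤ p ℚ.⊔ 0ℚ → q ℚ.⊔ 0ℚ ℚ.≤ (t ℚ.+ δ) ℚ.* (t ℚ.+ δ) →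
    p ℚ.≤ q ℚ.+ ε ℚ.* ε → δ ℚ.≤ ε → s ℚ.≤ t ℚ.+ (ε ℚ.+ ε)
  √-step {p} {q} {s} {t} {δ} {ε} 0≤t 0≤δ 0≤ε lower upper p≤ δ≤ε = begin
    s                   ≤⟨ sq-cancel-≤ (0≤+ 0≤r 0≤ε) sq ⟩
    r ℚ.+ ε             ≡⟨ ℚ.+-assoc t δ ε ⟩
    t ℚ.+ (δ ℚ.+ ε)     ≤⟨ ℚ.+-monoʳ-≤ t (ℚ.+-monoˡ-≤ ε δ≤ε) ⟩
    t ℚ.+ (ε ℚ.+ ε)     ∎
    where
    open ℚ.≤-Reasoning
    open ℚ-Solver
    r   = t ℚ.+ δ
    0≤r = 0≤+ 0≤t 0≤δ
    0≤rε : 0ℚ ℚ.≤ r ℚ.* ε ℚ.+ r ℚ.* ε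
    0≤rε = 0≤+ (0≤* 0≤r 0≤ε) (0≤* 0≤r 0≤ε)
    p⁺≤ : p ℚ.⊔ 0ℚ ℚ.≤ q ℚ.⊔ 0ℚ ℚ.+ ε ℚ.* ε
    p⁺≤ = ℚ.⊔-lub
      (ℚ.≤-trans p≤ (ℚ.+-monoˡ-≤ (ε ℚ.* ε) (ℚ.p≤p⊔q q 0ℚ)))
      (0≤+ (ℚ.p≤q⊔p q 0ℚ) (0≤* 0≤ε 0≤ε))
    sq : s ℚ.* s ℚ.≤ (r ℚ.+ ε) ℚ.* (r ℚ.+ ε)
    sq = begin
      s ℚ.* s                      ≤⟨ lower ⟩
      p ℚ.⊔ 0ℚ                     ≤⟨ p⁺≤ ⟩
      q ℚ.⊔ 0ℚ ℚ.+ ε ℚ.* ε         ≤⟨ ℚ.+-monoˡ-≤ (ε ℚ.* ε) upper ⟩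
      r ℚ.* r ℚ.+ ε ℚ.* ε          ≡⟨ ℚ.+-identityʳ (r ℚ.* r ℚ.+ ε ℚ.* ε) ⟨
      r ℚ.* r ℚ.+ ε ℚ.* ε ℚ.+ 0ℚ   ≤⟨ ℚ.+-monoʳ-≤ (r ℚ.* r ℚ.+ ε ℚ.* ε) 0≤rε ⟩
      r ℚ.* r ℚ.+ ε ℚ.* ε ℚ.+ (r ℚ.* ε ℚ.+ r ℚ.* ε)
        ≡⟨ solve 2 (λ r ε → r :* r :+ ε :* ε :+ (r :* ε :+ r :* ε) := (r :+ ε) :* (r :+ ε)) refl r ε ⟩
      (r ℚ.+ ε) ℚ.* (r ℚ.+ ε)      ∎

  -- The hypotheses are those satisfied by s n = √-approx (p n ⊔ 0) n.
  √-cauchy : ∀ (s p : ℕ → ℚ) → (∀ n → 0ℚ ℚ.≤ s n) →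
    (∀ n → s n ℚ.* s n ℚ.≤ p n ℚ.⊔ 0ℚ) →
    (∀ n → p n ℚ.⊔ 0ℚ ℚ.≤ (s n ℚ.+ + 1 ℚ./ suc n) ℚ.* (s n ℚ.+ + 1 ℚ./ suc n)) →
    IsCauchy p → IsCauchy s
  √-cauchy s p 0≤s lower upper cp ε 0<ε = N ℕ.⊔ M , λ m n m≥ n≥ →
    let close = hM m n (ℕ.m⊔n≤o⇒n≤o N M m≥) (ℕ.m⊔n≤o⇒n≤o N M n≥) in
    ∣-∣≤-intro
      (step m n (∣-∣≤-elimˡ {p m} {p n} close) (hN n (ℕ.m⊔n≤o⇒m≤o N M n≥)))
      (step n m (∣-∣≤-elimʳ {p m} {p n} close) (hN m (ℕ.m⊔n≤o⇒m≤o N M m≥)))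
    where
    η    = ½ ℚ.* ε
    0<η  = 0<½* 0<ε
    arch = archimedean η 0<η
    N    = proj₁ arch
    hN   = proj₂ arch
    cpη  = cp (η ℚ.* η) (0<* 0<η 0<η)
    M    = proj₁ cpη
    hM   = proj₂ cpη
    step : ∀ m n → p m ℚ.≤ p n ℚ.+ η ℚ.* η → + 1 ℚ./ suc n ℚ.≤ η → s m ℚ.≤ s n ℚ.+ ε
    step m n p≤ δ≤η = subst (λ e → s m ℚ.≤ s n ℚ.+ e) (p+½ε+½ε ε)
      (√-step {p m} {p n} {s m} {s n} {+ 1 ℚ./ suc n} {η} (0≤s n) (0≤/ 1 n) (ℚ.<⇒≤ 0<η) (lower m) (upper n) p≤ δ≤η)

-- Total square root: negative numbers are sent to 0.
√_ : ℝ → ℝ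
√ mkℝ a ca = mkℝ (λ n → √-approx (a n ℚ.⊔ 0ℚ) n)
  (√-cauchy (λ n → √-approx (a n ℚ.⊔ 0ℚ) n) a
    (λ n → √-approx-nonNeg (a n ℚ.⊔ 0ℚ) n)
    (λ n → √-approx-lower (a n ℚ.⊔ 0ℚ) n (ℚ.p≤q⊔p (a n) 0ℚ))
    (λ n → √-approx-upper (a n ℚ.⊔ 0ℚ) n)
    ca)

infix 9 √_

√-nonNeg : ∀ a → 0ℝ ≤ √ a
√-nonNeg a ε 0<ε = 0 , λ n _ →
  0≤+ (√-approx-nonNeg (seq a n ℚ.⊔ 0ℚ) n) (ℚ.<⇒≤ 0<ε)

private
  square-close : ∀ {p p⁺ s δ γ η} B → 0ℚ ℚ.≤ δ → 0ℚ ℚ.≤ η → 0ℚ ℚ.≤ B ℚ.+ B ℚ.+ 1ℚ →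
    s ℚ.≤ B → δ ℚ.≤ 1ℚ → δ ℚ.≤ γ → (B ℚ.+ B ℚ.+ 1ℚ) ℚ.* γ ≡ η →
    p ℚ.≤ p⁺ → p⁺ ℚ.≤ p ℚ.+ η →
    s ℚ.* s ℚ.≤ p⁺ → p⁺ ℚ.≤ (s ℚ.+ δ) ℚ.* (s ℚ.+ δ) →
    ∣ s ℚ.* s ℚ.- p ∣ ℚ.≤ η
  square-close {p} {p⁺} {s} {δ} {γ} {η} B 0≤δ 0≤η 0≤2B+1 s≤B δ≤1 δ≤γ eq p≤ p⁺≤ lower upper =
    ∣-∣≤-intro (ℚ.≤-trans lower p⁺≤) (begin
      p                                   ≤⟨ p≤ ⟩
      p⁺                                  ≤⟨ upper ⟩
      (s ℚ.+ δ) ℚ.* (s ℚ.+ δ)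
        ≡⟨ solve 2 (λ s δ → (s :+ δ) :* (s :+ δ) := s :* s :+ (s :+ s :+ δ) :* δ) refl s δ ⟩
      s ℚ.* s ℚ.+ (s ℚ.+ s ℚ.+ δ) ℚ.* δ
        ≤⟨ ℚ.+-monoʳ-≤ (s ℚ.* s) (*-mono-≤-nonNeg 0≤δ 0≤2B+1
             (ℚ.+-mono-≤ (ℚ.+-mono-≤ s≤B s≤B) δ≤1) δ≤γ) ⟩
      s ℚ.* s ℚ.+ (B ℚ.+ B ℚ.+ 1ℚ) ℚ.* γ  ≡⟨ cong (s ℚ.* s ℚ.+_) eq ⟩
      s ℚ.* s ℚ.+ η                       ∎)
    where open ℚ.≤-Reasoning
          open ℚ-Solver

  square-converges : ∀ (s p : ℕ → ℚ) →
    Σ[ B ∈ ℚ ] (0ℚ ℚ.< B × ∃[ N ] (∀ n → N ℕ.≤ n → ∣ s n ∣ ℚ.≤ B)) →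
    (∀ n → s n ℚ.* s n ℚ.≤ p n ℚ.⊔ 0ℚ) →
    (∀ n → p n ℚ.⊔ 0ℚ ℚ.≤ (s n ℚ.+ + 1 ℚ./ suc n) ℚ.* (s n ℚ.+ + 1 ℚ./ suc n)) →
    ∀ ε → 0ℚ ℚ.< ε → ∃[ N ] (∀ n → N ℕ.≤ n → 0ℚ ℚ.≤ p n ℚ.+ ε) →
    ∃[ N ] (∀ n → N ℕ.≤ n → ∣ s n ℚ.* s n ℚ.- p n ∣ ℚ.≤ ε)
  square-converges s p (B , 0<B , K , hK) lower upper ε 0<ε (M , hM) =
    K ℕ.⊔ (N ℕ.⊔ M) , close
    where
    0<2B+1 : 0ℚ ℚ.< B ℚ.+ B ℚ.+ 1ℚ
    0<2B+1 = ℚ.+-mono-< (ℚ.+-mono-< 0<B 0<B) (ℚ.positive⁻¹ 1ℚ)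

    div  = divide (B ℚ.+ B ℚ.+ 1ℚ) ε 0<2B+1 0<ε
    arch = archimedean (proj₁ div) (proj₁ (proj₂ div))
    N    = proj₁ arch

    close : ∀ n → K ℕ.⊔ (N ℕ.⊔ M) ℕ.≤ n → ∣ s n ℚ.* s n ℚ.- p n ∣ ℚ.≤ ε
    close n n≥ = square-close B (0≤/ 1 n) (ℚ.<⇒≤ 0<ε) (ℚ.<⇒≤ 0<2B+1)
      (ℚ.≤-trans (p≤∣p∣ (s n)) (hK n (ℕ.m⊔n≤o⇒m≤o K (N ℕ.⊔ M) n≥)))
      (/-mono {+ 1} {+ 1} {n} {0} (ℤ.+≤+ (ℕ.s≤s ℕ.z≤n)))
      (proj₂ arch n (ℕ.m⊔n≤o⇒m≤o N M n≥NM)) (proj₂ (proj₂ div))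
      (ℚ.p≤p⊔q (p n) 0ℚ)
      (ℚ.⊔-lub
        (subst (ℚ._≤ p n ℚ.+ ε) (ℚ.+-identityʳ (p n))
          (ℚ.+-monoʳ-≤ (p n) (ℚ.<⇒≤ 0<ε)))
        (hM n (ℕ.m⊔n≤o⇒n≤o N M n≥NM)))
      (lower n) (upper n)
      where n≥NM = ℕ.m⊔n≤o⇒n≤o K (N ℕ.⊔ M) n≥

√-square : ∀ a → 0ℝ ≤ a → √ a * √ a ≃ a
√-square a 0≤a ε 0<ε = square-converges (seq (√ a)) (seq a)
  (bounded {seq (√ a)} (cauchy (√ a)))
  (λ n → √-approx-lower (seq a n ℚ.⊔ 0ℚ) n (ℚ.p≤q⊔p (seq a n) 0ℚ))
  (λ n → √-approx-upper (seq a n ℚ.⊔ 0ℚ) n)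
  ε 0<ε (0≤a ε 0<ε)

{-# OPTIONS --safe #-}

-- Compatibility of colours is the x × x matrix A = J − D, with J all ones and
-- D the diagonal projection onto the colours 1, …, y, so P(C_n, x, y) is the
-- trace of A^n.  From A^(n+1) + D A^n = J A^n = (the row of column sums of A^n),
-- and the same on the right, T n = Σ A^n, S n = Σ A^n D and Δ n = tr (D A^n) satisfy
--   T (n+1) = x T n − S n,   S (n+1) = y T n − S n,
--   Δ (n+1) = S n − Δ n,     tr A^(n+1) = T n − Δ n,
-- and (T, S) has characteristic polynomial λ² − (x−1) λ − (x−y), whose roots are
-- the two numbers in the formula.  Hence tr A^n is their n-th power sum up to the
-- alternating term (−1)^n (y − 1).

module Submission where

open import Data.Bool.Base using (if_then_else_)
open import Data.Fin.Base
  using (Fin; zero; suc; toℕ; finToFun; combine; _↑ˡ_; _↑ʳ_)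
  renaming (fromℕ to lastFin)
import Data.Fin.Properties as Fin
import Data.Integer.Base as ℤ
import Data.Integer.Properties as ℤ
open import Data.List.Base using (length; filter; tabulate)
open import Data.Nat.Base as ℕ using (ℕ; zero; suc) renaming (_≤_ to _≤ℕ_)
import Data.Nat.Properties as ℕ
open import Data.Product.Base using (_×_; _,_; proj₁; proj₂)
open import Data.Rational.Base as ℚ using (ℚ; 0ℚ; 1ℚ; ½; ∣_∣)
import Data.Rational.Properties as ℚ
import Data.Rational.Solver as ℚ
import Data.Rational.Unnormalised.Base as ℚᵘ
import Data.Rational.Unnormalised.Properties as ℚᵘ
open import Data.Sum.Base using (_⊎_; inj₁; inj₂)
open import Function.Base using (_∘_; id)
open import Function.Bundles using (_⇔_; mk⇔; Equivalence)
open import Relation.Binary.PropositionalEquality hiding ([_])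
open import Relation.Nullary using (Dec; does; yes; no; ¬_; contradiction)
open import Relation.Nullary.Decidable using (_×-dec_; _⊎-dec_; ¬?)
open import Relation.Unary using (Pred; Decidable)
import Defs

-- Indicators and finite sums over `Fin n`.

module Counting where

  open import Data.Nat.Base hiding (_≤_)
  open import Data.Nat.Properties
  open import Data.Nat.Solver using (module +-*-Solver)
  open import Algebra.Properties.Semiring.Sum +-*-semiring
  open Defs using (Admissible; admissible?; Next; C; P; colour)

  -- Iverson bracket. It inspects only `does`, so brackets of compound decisions reduce without
  -- looking at proofs.
  [_] : ∀ {p} {A : Set p} → Dec A → ℕ
  [ A? ] = if does A? then 1 else 0

  []-true : ∀ {p} {A : Set p} (A? : Dec A) → A → [ A? ] ≡ 1
  []-true (yes _) _ = refl
  []-true (no ¬a) a = contradiction a ¬a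

  []-false : ∀ {p} {A : Set p} (A? : Dec A) → ¬ A → [ A? ] ≡ 0
  []-false (yes a) ¬a = contradiction a ¬a
  []-false (no _)  _  = refl

  []-cong : ∀ {p q} {A : Set p} {B : Set q} (A? : Dec A) (B? : Dec B) →
            A ⇔ B → [ A? ] ≡ [ B? ]
  []-cong A? (yes b) A⇔B = []-true A? (Equivalence.from A⇔B b)
  []-cong A? (no ¬b) A⇔B = []-false A? (¬b ∘ Equivalence.to A⇔B)

  []-× : ∀ {p q} {A : Set p} {B : Set q} (A? : Dec A) (B? : Dec B) →
         [ A? ×-dec B? ] ≡ [ A? ] * [ B? ]
  []-× (yes _) B? = sym (+-identityʳ [ B? ])
  []-× (no _)  _  = refl

  []-idem : ∀ {p} {A : Set p} (A? : Dec A) → [ A? ] * [ A? ] ≡ [ A? ]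
  []-idem (yes _) = refl
  []-idem (no _)  = refl

  [≟]-sym : ∀ {n} (a b : Fin n) → [ a Fin.≟ b ] ≡ [ b Fin.≟ a ]
  [≟]-sym a b = []-cong (a Fin.≟ b) (b Fin.≟ a) (mk⇔ sym sym)

  length-filter-tabulate :
    ∀ {a p} {A : Set a} {Q : Pred A p} (Q? : Decidable Q) {n} (f : Fin n → A) →
    length (filter Q? (tabulate f)) ≡ ∑[ i < n ] [ Q? (f i) ]
  length-filter-tabulate Q? {zero}  f = refl
  length-filter-tabulate Q? {suc n} f with Q? (f zero)
  ... | yes _ = cong suc (length-filter-tabulate Q? (f ∘ suc))
  ... | no  _ = length-filter-tabulate Q? (f ∘ suc)

  ∑-++ : ∀ m n (g : Fin (m + n) → ℕ) →
         sum g ≡ ∑[ i < m ] g (i ↑ˡ n) + ∑[ j < n ] g (m ↑ʳ j)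
  ∑-++ zero    n g = refl
  ∑-++ (suc m) n g = trans (cong (g zero +_) (∑-++ m n (g ∘ suc)))
                           (sym (+-assoc (g zero) _ _))

  -- `finToFun` decodes `combine c k` as the map with first value `c` and remaining values coded by
  -- `k`, so this peels one vertex off a sum over all maps.
  ∑-combine : ∀ m n (g : Fin (m * n) → ℕ) →
              sum g ≡ ∑[ i < m ] ∑[ j < n ] g (combine i j)
  ∑-combine zero    n g = refl
  ∑-combine (suc m) n g = trans (∑-++ n (m * n) g)
    (cong (∑[ j < n ] g (j ↑ˡ m * n) +_) (∑-combine m n (g ∘ (n ↑ʳ_))))

  ∑-const : ∀ n c → ∑[ i < n ] c ≡ n * c
  ∑-const zero    c = refl
  ∑-const (suc n) c = cong (c +_) (∑-const n c)

  ∑-indicator : ∀ {n} (a : Fin n) (g : Fin n → ℕ) →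
                ∑[ c < n ] ([ a Fin.≟ c ] * g c) ≡ g a
  ∑-indicator {suc n} zero g = begin
    g zero + 0 + ∑[ c < n ] 0  ≡⟨ cong₂ _+_ (+-identityʳ (g zero)) (sum-replicate-zero n) ⟩
    g zero + 0                 ≡⟨ +-identityʳ (g zero) ⟩
    g zero                     ∎
    where open ≡-Reasoning
  ∑-indicator {suc n} (suc a) g = trans
    (sum-cong-≗ λ c → cong (_* g (suc c))
      ([]-cong (suc a Fin.≟ suc c) (a Fin.≟ c) (mk⇔ Fin.suc-injective (cong suc))))
    (∑-indicator a (g ∘ suc))

  -- This is the trace of `D`. On the counting side, `y ≤ x` enters through this sum alone.
  ∑-[toℕ<] : ∀ {x} y → y ≤ℕ x → ∑[ a < x ] [ toℕ a <? y ] ≡ y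
  ∑-[toℕ<] {x}     zero    z≤n = sum-replicate-zero x
  ∑-[toℕ<] {suc x} (suc y) (s≤s y≤x) = cong suc (trans
    (sum-cong-≗ λ (a : Fin x) → []-cong (suc (toℕ a) <? suc y) (toℕ a <? y) (mk⇔ s≤s⁻¹ s≤s))
    (∑-[toℕ<] y y≤x))

  -- Colourings of a cycle as closed walks.

  module Walks (x y : ℕ) where

    infix 4 _~_ _~?_

    -- Definitionally what `Admissible` asks of one edge, so its proofs serve here without
    -- conversion.
    _~_ : Fin x → Fin x → Set
    a ~ b = a ≢ b ⊎ (a ≡ b × y < colour a)

    _~?_ : ∀ a b → Dec (a ~ b)
    a ~? b = ¬? (a Fin.≟ b) ⊎-dec ((a Fin.≟ b) ×-dec (y <? colour a))

    ~-sym : ∀ {a b} → a ~ b → b ~ a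
    ~-sym (inj₁ a≢b)          = inj₁ (a≢b ∘ sym)
    ~-sym (inj₂ (refl , y<a)) = inj₂ (refl , y<a)

    -- `f` holds only the `n` intermediate colours, so a walk has `n + 1` steps; hence the exponent
    -- `suc n` in `∑-walks`. A closed walk is one with equal endpoints.
    Walk : ∀ {n} → Fin x → (Fin n → Fin x) → Fin x → Set
    Walk {zero}  a f b = a ~ b
    Walk {suc n} a f b = a ~ f zero × Walk (f zero) (f ∘ suc) b

    walk? : ∀ {n} a (f : Fin n → Fin x) b → Dec (Walk a f b)
    walk? {zero}  a f b = a ~? b
    walk? {suc n} a f b = (a ~? f zero) ×-dec walk? (f zero) (f ∘ suc) b

    -- With its converse `walk⁺`, this trades the recursion of `Walk` for the two clauses of `Next`:
    -- successive indices, and the last index going on to `b`.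
    walk⁻ : ∀ {n} (f : Fin (suc n) → Fin x) b → Walk (f zero) (f ∘ suc) b →
            (∀ v w → toℕ w ≡ suc (toℕ v) → f v ~ f w) × f (lastFin n) ~ b
    walk⁻ {zero}  f b f~b = (λ { zero zero () }) , f~b
    walk⁻ {suc n} f b (f₀~f₁ , walk) = steps , proj₂ rest
      where
      rest = walk⁻ (f ∘ suc) b walk
      steps : ∀ v w → toℕ w ≡ suc (toℕ v) → f v ~ f w
      steps zero    (suc zero) _  = f₀~f₁
      steps (suc v) (suc w)    eq = proj₁ rest v w (suc-injective eq)

    walk⁺ : ∀ {n} (f : Fin (suc n) → Fin x) b →
            (∀ v w → toℕ w ≡ suc (toℕ v) → f v ~ f w) → f (lastFin n) ~ b →
            Walk (f zero) (f ∘ suc) b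
    walk⁺ {zero}  f b steps f~b = f~b
    walk⁺ {suc n} f b steps f~b =
      steps zero (suc zero) refl ,
      walk⁺ (f ∘ suc) b (λ v w eq → steps (suc v) (suc w) (cong suc eq)) f~b

    -- The wraparound edge is the closing step of the walk. Going round in one direction suffices
    -- because `_~_` is symmetric.
    admissible⇔walk : ∀ n (3≤n : 3 ≤ℕ suc n) (f : Fin (suc n) → Fin x) →
      Admissible (C (suc n) 3≤n) x y f ⇔ Walk (f zero) (f ∘ suc) (f zero)
    admissible⇔walk n 3≤n f = mk⇔ to from
      where
      to : Admissible (C (suc n) 3≤n) x y f → Walk (f zero) (f ∘ suc) (f zero)
      to adm = walk⁺ f (f zero) (λ v w eq → adm v w (inj₁ (inj₁ eq)))
        (adm (lastFin n) zero (inj₁ (inj₂ (cong suc (Fin.toℕ-fromℕ n) , refl))))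

      from : Walk (f zero) (f ∘ suc) (f zero) → Admissible (C (suc n) 3≤n) x y f
      from walk v w = λ { (inj₁ v→w) → next v→w ; (inj₂ w→v) → ~-sym (next w→v) }
        where
        next : ∀ {v w} → Next v w → f v ~ f w
        next {v} {w} (inj₁ eq)           = proj₁ (walk⁻ f (f zero) walk) v w eq
        next {v} {w} (inj₂ (v≡n , w≡0)) =
          subst₂ (λ v w → f v ~ f w)
            (Fin.toℕ-injective (trans (Fin.toℕ-fromℕ n) (sym (cong pred v≡n))))
            (Fin.toℕ-injective (sym w≡0))
            (proj₂ (walk⁻ f (f zero) walk))

    A^ : ℕ → Fin x → Fin x → ℕ
    A^ zero    a b = [ a Fin.≟ b ]
    A^ (suc n) a b = ∑[ c < x ] ([ a ~? c ] * A^ n c b)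

    -- Summing over the first intermediate colour is one matrix multiplication by `A`.
    ∑-walks : ∀ n a b → ∑[ k < x ^ n ] [ walk? a (finToFun {x} {n} k) b ] ≡ A^ (suc n) a b
    ∑-walks zero a b = begin
      [ a ~? b ] + 0
        ≡⟨ +-identityʳ _ ⟩
      [ a ~? b ]
        ≡⟨ ∑-indicator b (λ c → [ a ~? c ]) ⟨
      ∑[ c < x ] ([ b Fin.≟ c ] * [ a ~? c ])
        ≡⟨ sum-cong-≗ {x} (λ c → trans (*-comm [ b Fin.≟ c ] _)
             (cong ([ a ~? c ] *_) ([≟]-sym b c))) ⟩
      ∑[ c < x ] ([ a ~? c ] * [ c Fin.≟ b ])
        ∎
      where open ≡-Reasoning
    ∑-walks (suc n) a b = begin
      ∑[ k < x * x ^ n ] [ walk? a (finToFun {x} {suc n} k) b ]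
        ≡⟨ ∑-combine x (x ^ n) _ ⟩
      ∑[ c < x ] ∑[ k < x ^ n ] [ walk? a (finToFun {x} {suc n} (combine c k)) b ]
        ≡⟨ sum-cong-≗ {x} (λ c → trans (sum-cong-≗ {x ^ n} (split c))
             (sym (*-distribˡ-sum {x ^ n} [ a ~? c ] _))) ⟩
      ∑[ c < x ] ([ a ~? c ] * ∑[ k < x ^ n ] [ walk? c (finToFun {x} {n} k) b ])
        ≡⟨ sum-cong-≗ {x} (λ c → cong ([ a ~? c ] *_) (∑-walks n c b)) ⟩
      ∑[ c < x ] ([ a ~? c ] * A^ (suc n) c b)
        ∎
      where
      open ≡-Reasoning
      split : ∀ c k → [ walk? a (finToFun {x} {suc n} (combine c k)) b ]
                      ≡ [ a ~? c ] * [ walk? c (finToFun {x} {n} k) b ]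
      split c k = trans
        (cong (λ (c , k) → [ (a ~? c) ×-dec walk? c (finToFun {x} {n} k) b ])
          (Fin.remQuot-combine {x} c k))
        ([]-× (a ~? c) (walk? c (finToFun {x} {n} k) b))

    tr : ℕ → ℕ
    tr n = ∑[ a < x ] A^ n a a

    -- Fixing the colour `a` of vertex 0 leaves the closed walks at `a`, a diagonal entry of the
    -- power.
    P≡tr : ∀ n (3≤n : 3 ≤ℕ n) → P (C n 3≤n) x y ≡ tr n
    P≡tr (suc n) 3≤n = begin
      P (C (suc n) 3≤n) x y
        ≡⟨ length-filter-tabulate (λ k → admissible? (C (suc n) 3≤n) x y (finToFun k)) id ⟩
      ∑[ k < x * x ^ n ] [ admissible? (C (suc n) 3≤n) x y (finToFun {x} {suc n} k) ]
        ≡⟨ sum-cong-≗ {x * x ^ n} (λ k → let f = finToFun {x} {suc n} k in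
             []-cong (admissible? (C (suc n) 3≤n) x y f) (walk? (f zero) (f ∘ suc) (f zero))
               (admissible⇔walk n 3≤n f)) ⟩
      ∑[ k < x * x ^ n ] closed (finToFun {x} {suc n} k zero) (finToFun {x} {suc n} k ∘ suc)
        ≡⟨ ∑-combine x (x ^ n) _ ⟩
      ∑[ a < x ] ∑[ k < x ^ n ] closed (finToFun {x} {suc n} (combine a k) zero)
                                       (finToFun {x} {suc n} (combine a k) ∘ suc)
        ≡⟨ sum-cong-≗ {x} (λ a → trans
             (sum-cong-≗ {x ^ n} λ k → cong (λ (a , k) → closed a (finToFun {x} {n} k))
               (Fin.remQuot-combine {x} a k))
             (∑-walks n a a)) ⟩
      tr (suc n)
        ∎
      where
      open ≡-Reasoning
      closed : Fin x → (Fin n → Fin x) → ℕ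
      closed a f = [ walk? a f a ]

    -- The decomposition `A + D = J` and the recurrences it yields.

    low : Fin x → ℕ
    low a = [ toℕ a <? y ]

    -- Colours are shifted by one, so `low a` marks those at most `y`. On the diagonal exactly one
    -- of `toℕ a < y` and `y < colour a` holds; off it, compatibility is automatic. The additive
    -- form keeps the entries in ℕ.
    A+D≡J : ∀ a b → [ a ~? b ] + low a * [ a Fin.≟ b ] ≡ 1
    A+D≡J a b = by-cases (a Fin.≟ b) (toℕ a <? y) (y <? colour a)
      where
      by-cases : (a≟b : Dec (a ≡ b)) (a<?y : Dec (toℕ a < y)) (y<?a : Dec (y < colour a)) →
        [ ¬? a≟b ⊎-dec (a≟b ×-dec y<?a) ] + [ a<?y ] * [ a≟b ] ≡ 1
      by-cases (yes _) (yes a<y) (yes y<a) = contradiction y<a (≤⇒≯ a<y)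
      by-cases (yes _) (yes _)   (no  _)   = refl
      by-cases (yes _) (no  _)   (yes _)   = refl
      by-cases (yes _) (no  a≮y) (no y≮a)  = contradiction (s≤s (≮⇒≥ a≮y)) y≮a
      by-cases (no  _) (yes _)   _         = refl
      by-cases (no  _) (no  _)   _         = refl

    -- `A` commutes with its powers, which lets `stepʳ` multiply by `A + D` on the right.
    A^-sucʳ : ∀ n a b → A^ (suc n) a b ≡ ∑[ c < x ] (A^ n a c * [ c ~? b ])
    A^-sucʳ zero a b = begin
      ∑[ c < x ] ([ a ~? c ] * [ c Fin.≟ b ])
        ≡⟨ sum-cong-≗ {x} (λ c → trans (*-comm [ a ~? c ] _)
             (cong (_* [ a ~? c ]) ([≟]-sym c b))) ⟩
      ∑[ c < x ] ([ b Fin.≟ c ] * [ a ~? c ])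
        ≡⟨ ∑-indicator b (λ c → [ a ~? c ]) ⟩
      [ a ~? b ]
        ≡⟨ ∑-indicator a (λ c → [ c ~? b ]) ⟨
      ∑[ c < x ] ([ a Fin.≟ c ] * [ c ~? b ])
        ∎
      where open ≡-Reasoning
    A^-sucʳ (suc n) a b = begin
      ∑[ c < x ] ([ a ~? c ] * A^ (suc n) c b)
        ≡⟨ sum-cong-≗ {x} (λ c → trans (cong ([ a ~? c ] *_) (A^-sucʳ n c b))
             (*-distribˡ-sum {x} [ a ~? c ] _)) ⟩
      ∑[ c < x ] ∑[ e < x ] ([ a ~? c ] * (A^ n c e * [ e ~? b ]))
        ≡⟨ ∑-comm {x} {x} _ ⟩
      ∑[ e < x ] ∑[ c < x ] ([ a ~? c ] * (A^ n c e * [ e ~? b ]))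
        ≡⟨ sum-cong-≗ {x} (λ e → trans
             (sum-cong-≗ {x} λ c → sym (*-assoc [ a ~? c ] (A^ n c e) [ e ~? b ]))
             (sym (*-distribʳ-sum {x} [ e ~? b ] _))) ⟩
      ∑[ e < x ] (A^ (suc n) a e * [ e ~? b ])
        ∎
      where open ≡-Reasoning

    col : ℕ → Fin x → ℕ
    col n b = ∑[ a < x ] A^ n a b

    -- An entry of `(A + D) A^n = J A^n`.
    stepˡ : ∀ n a b → A^ (suc n) a b + low a * A^ n a b ≡ col n b
    stepˡ n a b = begin
      A^ (suc n) a b + low a * A^ n a b
        ≡⟨ cong (λ z → A^ (suc n) a b + low a * z) (∑-indicator a (λ c → A^ n c b)) ⟨
      A^ (suc n) a b + low a * ∑[ c < x ] ([ a Fin.≟ c ] * A^ n c b)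
        ≡⟨ cong (A^ (suc n) a b +_) (*-distribˡ-sum {x} (low a) _) ⟩
      A^ (suc n) a b + ∑[ c < x ] (low a * ([ a Fin.≟ c ] * A^ n c b))
        ≡⟨ ∑-distrib-+ {x} _ _ ⟨
      ∑[ c < x ] ([ a ~? c ] * A^ n c b + low a * ([ a Fin.≟ c ] * A^ n c b))
        ≡⟨ sum-cong-≗ {x} (λ c → trans
             (solve 4 (λ p q r s → p :* s :+ q :* (r :* s) := (p :+ q :* r) :* s) refl
               [ a ~? c ] (low a) [ a Fin.≟ c ] (A^ n c b))
             (trans (cong (_* A^ n c b) (A+D≡J a c)) (*-identityˡ (A^ n c b)))) ⟩
      col n b
        ∎
      where open ≡-Reasoning
            open +-*-Solver

    -- An entry of `A^n (A + D) = A^n J`; symmetry of `_~_` lets `A+D≡J` be applied at row `b`.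
    stepʳ : ∀ n a b → A^ (suc n) a b + low b * A^ n a b ≡ ∑[ c < x ] A^ n a c
    stepʳ n a b = begin
      A^ (suc n) a b + low b * A^ n a b
        ≡⟨ cong₂ (λ z w → z + low b * w) (A^-sucʳ n a b) (sym (∑-indicator b (A^ n a))) ⟩
      ∑[ c < x ] (A^ n a c * [ c ~? b ]) + low b * ∑[ c < x ] ([ b Fin.≟ c ] * A^ n a c)
        ≡⟨ cong (∑[ c < x ] (A^ n a c * [ c ~? b ]) +_) (*-distribˡ-sum {x} (low b) _) ⟩
      ∑[ c < x ] (A^ n a c * [ c ~? b ]) + ∑[ c < x ] (low b * ([ b Fin.≟ c ] * A^ n a c))
        ≡⟨ ∑-distrib-+ {x} _ _ ⟨
      ∑[ c < x ] (A^ n a c * [ c ~? b ] + low b * ([ b Fin.≟ c ] * A^ n a c))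
        ≡⟨ sum-cong-≗ {x} (λ c → trans
             (cong (λ z → A^ n a c * z + low b * ([ b Fin.≟ c ] * A^ n a c))
               ([]-cong (c ~? b) (b ~? c) (mk⇔ ~-sym ~-sym)))
             (trans
               (solve 4 (λ p q r s → s :* p :+ q :* (r :* s) := (p :+ q :* r) :* s) refl
                 [ b ~? c ] (low b) [ b Fin.≟ c ] (A^ n a c))
               (trans (cong (_* A^ n a c) (A+D≡J b c)) (*-identityˡ (A^ n a c))))) ⟩
      ∑[ c < x ] A^ n a c
        ∎
      where open ≡-Reasoning
            open +-*-Solver

    T S Δ : ℕ → ℕ
    T n = ∑[ b < x ] col n b
    S n = ∑[ b < x ] (low b * col n b)
    Δ n = ∑[ a < x ] (low a * A^ n a a)

    -- Summing `stepʳ` over `a` turns its right side into the total of all entries, independent of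
    -- `b`.
    col-step : ∀ n b → col (suc n) b + low b * col n b ≡ T n
    col-step n b = begin
      col (suc n) b + low b * col n b
        ≡⟨ cong (col (suc n) b +_) (*-distribˡ-sum {x} (low b) _) ⟩
      col (suc n) b + ∑[ a < x ] (low b * A^ n a b)
        ≡⟨ ∑-distrib-+ {x} _ _ ⟨
      ∑[ a < x ] (A^ (suc n) a b + low b * A^ n a b)
        ≡⟨ sum-cong-≗ {x} (λ a → stepʳ n a b) ⟩
      ∑[ a < x ] ∑[ c < x ] A^ n a c
        ≡⟨ ∑-comm {x} {x} _ ⟩
      T n
        ∎
      where open ≡-Reasoning

    T-suc : ∀ n → T (suc n) + S n ≡ x * T n
    T-suc n = trans (sym (∑-distrib-+ {x} _ _))
      (trans (sum-cong-≗ {x} (col-step n)) (∑-const x (T n)))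

    -- Multiplying by `D` leaves the term already weighted by `D` unchanged, because `D² = D`.
    low-weighted : ∀ {g h : Fin x → ℕ} {i : Fin x → ℕ} →
      (∀ b → g b + low b * h b ≡ i b) →
      ∑[ b < x ] (low b * g b) + ∑[ b < x ] (low b * h b) ≡ ∑[ b < x ] (low b * i b)
    low-weighted {g} {h} eq = trans (sym (∑-distrib-+ {x} _ _)) (sum-cong-≗ {x} λ b →
      trans (cong (low b * g b +_) (trans (cong (_* h b) (sym ([]-idem (toℕ b <? y))))
        (*-assoc (low b) (low b) (h b))))
        (trans (sym (*-distribˡ-+ (low b) (g b) (low b * h b))) (cong (low b *_) (eq b))))

    S-suc : y ≤ℕ x → ∀ n → S (suc n) + S n ≡ y * T n
    S-suc y≤x n = trans (low-weighted (col-step n))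
      (trans (sym (*-distribʳ-sum {x} (T n) low)) (cong (_* T n) (∑-[toℕ<] y y≤x)))

    Δ-suc : ∀ n → Δ (suc n) + Δ n ≡ S n
    Δ-suc n = low-weighted λ a → stepˡ n a a

    tr-suc : ∀ n → tr (suc n) + Δ n ≡ T n
    tr-suc n = trans (sym (∑-distrib-+ {x} _ _)) (sum-cong-≗ {x} λ a → stepˡ n a a)

    col-zero : ∀ b → col 0 b ≡ 1
    col-zero b = trans
      (sum-cong-≗ {x} λ a → trans ([≟]-sym a b) (sym (*-identityʳ _)))
      (∑-indicator b λ _ → 1)

    T-zero : T 0 ≡ x
    T-zero = trans (sum-cong-≗ {x} col-zero) (trans (∑-const x 1) (*-identityʳ x))

    S-zero : y ≤ℕ x → S 0 ≡ y
    S-zero y≤x = trans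
      (sum-cong-≗ {x} λ b → trans (cong (low b *_) (col-zero b)) (*-identityʳ (low b)))
      (∑-[toℕ<] y y≤x)

    Δ-zero : y ≤ℕ x → Δ 0 ≡ y
    Δ-zero y≤x = trans
      (sum-cong-≗ {x} λ a → trans (cong (low a *_) ([]-true (a Fin.≟ a) refl)) (*-identityʳ (low a)))
      (∑-[toℕ<] y y≤x)

-- Equality of reals as a congruence.

open import Defs
open Rational
  using (∣p-q∣≡∣q-p∣; 0<½*; p+½ε+½ε; 0≤*; 0≤+; 0≤/; *-mono-≤-nonNeg; toℚᵘ-/; /-mono)

-- Unlike _≃_, which unfolds, a record lets Agda infer the two reals from a
-- proof of their equality.
record _≈_ (a b : ℝ) : Set where
  constructor wrap
  field
    unwrap : a ≃ b

open _≈_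

infix 4 _≈_

-- Arithmetic on ℝ is termwise, so ring identities in ℝ reduce through this to identities in ℚ for
-- the solver.
≗⇒≈ : ∀ {a b} → seq a ≗ seq b → a ≈ b
≗⇒≈ {a} {b} eq .unwrap ε 0<ε = 0 , λ n _ → begin
  ∣ seq a n ℚ.- seq b n ∣  ≡⟨ cong (λ q → ∣ q ℚ.- seq b n ∣) (eq n) ⟩
  ∣ seq b n ℚ.- seq b n ∣  ≡⟨ cong ∣_∣ (ℚ.+-inverseʳ (seq b n)) ⟩
  0ℚ                       ≤⟨ ℚ.<⇒≤ 0<ε ⟩
  ε                        ∎
  where open ℚ.≤-Reasoning

-- Transitivity and compatibility with + are instances of this estimate, since
-- both split e − f as (a − b) + (c − d).
≈-combine : ∀ {a b c d e f} → a ≈ b → c ≈ d →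
  (∀ n → seq e n ℚ.- seq f n ≡ (seq a n ℚ.- seq b n) ℚ.+ (seq c n ℚ.- seq d n)) →
  e ≈ f
≈-combine {a} {b} {c} {d} {e} {f} a≈b c≈d eq .unwrap ε 0<ε =
  let
    N , hN = unwrap a≈b (½ ℚ.* ε) (0<½* 0<ε)
    M , hM = unwrap c≈d (½ ℚ.* ε) (0<½* 0<ε)
  in N ℕ.⊔ M , λ n n≥ → begin
  ∣ seq e n ℚ.- seq f n ∣
    ≡⟨ cong ∣_∣ (eq n) ⟩
  ∣ (seq a n ℚ.- seq b n) ℚ.+ (seq c n ℚ.- seq d n) ∣
    ≤⟨ ℚ.∣p+q∣≤∣p∣+∣q∣ (seq a n ℚ.- seq b n) (seq c n ℚ.- seq d n) ⟩
  ∣ seq a n ℚ.- seq b n ∣ ℚ.+ ∣ seq c n ℚ.- seq d n ∣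
    ≤⟨ ℚ.+-mono-≤ (hN n (ℕ.m⊔n≤o⇒m≤o N M n≥)) (hM n (ℕ.m⊔n≤o⇒n≤o N M n≥)) ⟩
  ½ ℚ.* ε ℚ.+ ½ ℚ.* ε
    ≡⟨ p+½ε+½ε ε ⟩
  ε ∎
  where open ℚ.≤-Reasoning

≈-sym : ∀ {a b} → a ≈ b → b ≈ a
≈-sym {a} {b} a≈b .unwrap ε 0<ε = let N , hN = unwrap a≈b ε 0<ε in N , λ n n≥ →
  subst (ℚ._≤ ε) (∣p-q∣≡∣q-p∣ (seq a n) (seq b n)) (hN n n≥)

≈-trans : ∀ {a b c} → a ≈ b → b ≈ c → a ≈ c
≈-trans {a} {b} {c} a≈b b≈c = ≈-combine a≈b b≈c λ n →
  solve 3 (λ p q r → p :- r := (p :- q) :+ (q :- r)) refl (seq a n) (seq b n) (seq c n)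
  where open ℚ.+-*-Solver

+-cong : ∀ a b c d → a ≈ b → c ≈ d → a + c ≈ b + d
+-cong a b c d a≈b c≈d = ≈-combine a≈b c≈d λ n →
  solve 4 (λ p q r s → (p :+ r) :- (q :+ s) := (p :- q) :+ (r :- s)) refl
    (seq a n) (seq b n) (seq c n) (seq d n)
  where open ℚ.+-*-Solver

-- `c` is eventually bounded by some `B`, so it is enough that `a` and `b` are eventually within
-- `ε / B`.
*-congˡ : ∀ c a b → a ≈ b → c * a ≈ c * b
*-congˡ c a b a≈b .unwrap ε 0<ε =
  let
    B , 0<B , N , hN = bounded {seq c} (cauchy c)
    δ , 0<δ , Bδ≡ε   = divide B ε 0<B 0<ε
    M , hM           = unwrap a≈b δ 0<δ
  in N ℕ.⊔ M , λ n n≥ → begin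
  ∣ seq c n ℚ.* seq a n ℚ.- seq c n ℚ.* seq b n ∣
    ≡⟨ cong ∣_∣ (solve 3 (λ p q r → p :* q :- p :* r := p :* (q :- r)) refl
         (seq c n) (seq a n) (seq b n)) ⟩
  ∣ seq c n ℚ.* (seq a n ℚ.- seq b n) ∣
    ≡⟨ ℚ.∣p*q∣≡∣p∣*∣q∣ (seq c n) (seq a n ℚ.- seq b n) ⟩
  ∣ seq c n ∣ ℚ.* ∣ seq a n ℚ.- seq b n ∣
    ≤⟨ *-mono-≤-nonNeg {∣ seq c n ∣} {B} {∣ seq a n ℚ.- seq b n ∣} {δ}
         (ℚ.0≤∣p∣ (seq a n ℚ.- seq b n)) (ℚ.<⇒≤ 0<B)
         (hN n (ℕ.m⊔n≤o⇒m≤o N M n≥)) (hM n (ℕ.m⊔n≤o⇒n≤o N M n≥)) ⟩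
  B ℚ.* δ
    ≡⟨ Bδ≡ε ⟩
  ε ∎
  where open ℚ.≤-Reasoning
        open ℚ.+-*-Solver

-- Natural numbers inside ℚ.

fromℕℚ : ℕ → ℚ
fromℕℚ n = ℤ.+ n ℚ./ 1

-- Normalisation in ℚ is stuck on a variable numerator, so equations are checked among unnormalised
-- fractions.
toℚᵘ-injective-/1 : ∀ p n → ℚ.toℚᵘ p ℚᵘ.≃ ℚᵘ.mkℚᵘ (ℤ.+ n) 0 → p ≡ fromℕℚ n
toℚᵘ-injective-/1 p n eq =
  ℚ.toℚᵘ-injective (ℚᵘ.≃-trans eq (ℚᵘ.≃-sym (toℚᵘ-/ (ℤ.+ n) 0)))

fromℕℚ-+ : ∀ m n → fromℕℚ m ℚ.+ fromℕℚ n ≡ fromℕℚ (m ℕ.+ n)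
fromℕℚ-+ m n = toℚᵘ-injective-/1 (fromℕℚ m ℚ.+ fromℕℚ n) (m ℕ.+ n)
  (ℚᵘ.≃-trans (ℚ.toℚᵘ-homo-+ (fromℕℚ m) (fromℕℚ n))
  (ℚᵘ.≃-trans (ℚᵘ.+-cong (toℚᵘ-/ (ℤ.+ m) 0) (toℚᵘ-/ (ℤ.+ n) 0))
    (ℚᵘ.*≡* (cong (ℤ._* ℤ.+ 1)
      (cong₂ ℤ._+_ (ℤ.*-identityʳ (ℤ.+ m)) (ℤ.*-identityʳ (ℤ.+ n)))))))

fromℕℚ-* : ∀ m n → fromℕℚ m ℚ.* fromℕℚ n ≡ fromℕℚ (m ℕ.* n)
fromℕℚ-* m n = toℚᵘ-injective-/1 (fromℕℚ m ℚ.* fromℕℚ n) (m ℕ.* n)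
  (ℚᵘ.≃-trans (ℚ.toℚᵘ-homo-* (fromℕℚ m) (fromℕℚ n))
  (ℚᵘ.≃-trans (ℚᵘ.*-cong (toℚᵘ-/ (ℤ.+ m) 0) (toℚᵘ-/ (ℤ.+ n) 0))
    (ℚᵘ.*≡* (cong (ℤ._* ℤ.+ 1) (sym (ℤ.pos-* m n))))))

fromℕℚ-mono : ∀ m n → m ≤ℕ n → fromℕℚ m ℚ.≤ fromℕℚ n
fromℕℚ-mono m n m≤n =
  /-mono {ℤ.+ m} {ℤ.+ n} {0} {0} (ℤ.*-monoʳ-≤-nonNeg (ℤ.+ 1) (ℤ.+≤+ m≤n))

-- Solving the recurrences over ℚ.

-- The sums of n-th powers of the two roots of γ² = t γ + q.
powerSum : ℚ → ℚ → ℕ → ℚ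
powerSum t q 0             = 1ℚ ℚ.+ 1ℚ
powerSum t q 1             = t
powerSum t q (suc (suc n)) = t ℚ.* powerSum t q (suc n) ℚ.+ q ℚ.* powerSum t q n

sign : ℕ → ℚ
sign zero    = 1ℚ
sign (suc n) = ℚ.- 1ℚ ℚ.* sign n

module Recurrences (x y : ℚ) where

  private
    u : ℕ → ℚ
    u = powerSum (x ℚ.- 1ℚ) (x ℚ.- y)

  module _ {T S Δ E : ℕ → ℚ} (T-zero : T 0 ≡ x) (S-zero : S 0 ≡ y) (Δ-zero : Δ 0 ≡ y)
    (T-suc : ∀ n → T (suc n) ≡ x ℚ.* T n ℚ.- S n)
    (S-suc : ∀ n → S (suc n) ≡ y ℚ.* T n ℚ.- S n)
    (Δ-suc : ∀ n → Δ (suc n) ≡ S n ℚ.- Δ n)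
    (E≡T-Δ : ∀ n → E n ≡ T n ℚ.- Δ n)
    where

    open ℚ.+-*-Solver
    open ≡-Reasoning

    -- (x + 1) T n − 2 S n satisfies the same second-order recurrence as u.
    u-step : ∀ n → u (suc (suc n)) ℚ.+ u (suc n)
                   ≡ (x ℚ.+ 1ℚ) ℚ.* T n ℚ.- (S n ℚ.+ S n)
    u-step 0 rewrite T-zero | S-zero =
      solve 2 (λ x y → ((x :- con 1ℚ) :* (x :- con 1ℚ) :+ (x :- y) :* (con 1ℚ :+ con 1ℚ))
                         :+ (x :- con 1ℚ)
                       := (x :+ con 1ℚ) :* x :- (y :+ y)) refl x y
    u-step 1 rewrite T-suc 0 | S-suc 0 | T-zero | S-zero =
      solve 2 (λ x y → let t = x :- con 1ℚ; q = x :- y; u₂ = t :* t :+ q :* (con 1ℚ :+ con 1ℚ)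
                           s₁ = y :* x :- y in
                       (t :* u₂ :+ q :* t) :+ u₂
                       := (x :+ con 1ℚ) :* (x :* x :- y) :- (s₁ :+ s₁)) refl x y
    u-step (suc (suc n)) = begin
      u (4 ℕ.+ n) ℚ.+ u (3 ℕ.+ n)
        ≡⟨ solve 5 (λ t q u v w → (t :* u :+ q :* v) :+ (t :* v :+ q :* w)
                                  := t :* (u :+ v) :+ q :* (v :+ w)) refl
             (x ℚ.- 1ℚ) (x ℚ.- y) (u (3 ℕ.+ n)) (u (2 ℕ.+ n)) (u (1 ℕ.+ n)) ⟩
      (x ℚ.- 1ℚ) ℚ.* (u (3 ℕ.+ n) ℚ.+ u (2 ℕ.+ n))
        ℚ.+ (x ℚ.- y) ℚ.* (u (2 ℕ.+ n) ℚ.+ u (1 ℕ.+ n))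
        ≡⟨ cong₂ (λ p r → (x ℚ.- 1ℚ) ℚ.* p ℚ.+ (x ℚ.- y) ℚ.* r)
             (u-step (suc n)) (u-step n) ⟩
      (x ℚ.- 1ℚ) ℚ.* v (T (suc n)) (S (suc n)) ℚ.+ (x ℚ.- y) ℚ.* v (T n) (S n)
        ≡⟨ cong₂ (λ a b → (x ℚ.- 1ℚ) ℚ.* v a b ℚ.+ (x ℚ.- y) ℚ.* v (T n) (S n))
             (T-suc n) (S-suc n) ⟩
      (x ℚ.- 1ℚ) ℚ.* v (t₁ (T n) (S n)) (s₁ (T n) (S n)) ℚ.+ (x ℚ.- y) ℚ.* v (T n) (S n)
        -- Cayley-Hamilton for the matrix with rows `(x, −1)` and `(y, −1)` that advances `(T, S)`:
        -- its trace is `x − 1`, its determinant `y − x`.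
        ≡⟨ solve 4 (λ x y a b →
             let a₁ = x :* a :- b; b₁ = y :* a :- b; a₂ = x :* a₁ :- b₁; b₂ = y :* a₁ :- b₁ in
             (x :- con 1ℚ) :* ((x :+ con 1ℚ) :* a₁ :- (b₁ :+ b₁))
               :+ (x :- y) :* ((x :+ con 1ℚ) :* a :- (b :+ b))
             := (x :+ con 1ℚ) :* a₂ :- (b₂ :+ b₂)) refl x y (T n) (S n) ⟩
      v (t₁ (t₁ (T n) (S n)) (s₁ (T n) (S n))) (s₁ (t₁ (T n) (S n)) (s₁ (T n) (S n)))
        ≡⟨ cong₂ (λ a b → v (t₁ a b) (s₁ a b)) (T-suc n) (S-suc n) ⟨
      v (t₁ (T (suc n)) (S (suc n))) (s₁ (T (suc n)) (S (suc n)))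
        ≡⟨ cong₂ v (T-suc (suc n)) (S-suc (suc n)) ⟨
      v (T (suc (suc n))) (S (suc (suc n)))
        ∎
      where
      v t₁ s₁ : ℚ → ℚ → ℚ
      v a b = (x ℚ.+ 1ℚ) ℚ.* a ℚ.- (b ℚ.+ b)
      t₁ a b = x ℚ.* a ℚ.- b
      s₁ a b = y ℚ.* a ℚ.- b

    -- `E n` stands for the trace of `A^(n+1)`. Both `E (n+1) + E n` and `u (n+2) + u (n+1)` equal
    -- `(x + 1) T n − 2 S n`, so `E n − u (n+1)` merely changes sign with `n`; at `n = 0` it is
    -- `1 − y`.
    trace-formula : ∀ n → E n ≡ u (suc n) ℚ.+ sign (suc n) ℚ.* (y ℚ.- 1ℚ)
    trace-formula zero rewrite E≡T-Δ 0 | T-zero | Δ-zero =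
      solve 2 (λ x y → x :- y := (x :- con 1ℚ) :+ (:- con 1ℚ) :* con 1ℚ :* (y :- con 1ℚ)) refl x y
    trace-formula (suc n) = begin
      E (suc n)
        ≡⟨ E≡T-Δ (suc n) ⟩
      T (suc n) ℚ.- Δ (suc n)
        ≡⟨ cong₂ ℚ._-_ (T-suc n) (Δ-suc n) ⟩
      (x ℚ.* T n ℚ.- S n) ℚ.- (S n ℚ.- Δ n)
        ≡⟨ solve 4 (λ x t s d → (x :* t :- s) :- (s :- d)
                                := ((x :+ con 1ℚ) :* t :- (s :+ s)) :- (t :- d)) refl
             x (T n) (S n) (Δ n) ⟩
      ((x ℚ.+ 1ℚ) ℚ.* T n ℚ.- (S n ℚ.+ S n)) ℚ.- (T n ℚ.- Δ n)
        ≡⟨ cong₂ ℚ._-_ (u-step n) (trans (sym (trace-formula n)) (E≡T-Δ n)) ⟨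
      (u (suc (suc n)) ℚ.+ u (suc n))
        ℚ.- (u (suc n) ℚ.+ sign (suc n) ℚ.* (y ℚ.- 1ℚ))
        ≡⟨ solve 4 (λ u v s y → (u :+ v) :- (v :+ s :* (y :- con 1ℚ))
                                := u :+ (:- con 1ℚ) :* s :* (y :- con 1ℚ)) refl
             (u (suc (suc n))) (u (suc n)) (sign (suc n)) y ⟩
      u (suc (suc n)) ℚ.+ sign (suc (suc n)) ℚ.* (y ℚ.- 1ℚ)
        ∎

-- Carries the additive recurrences in ℕ to the subtractive ones that `Recurrences` takes.
fromℕℚ-∸ : ∀ m n k → m ℕ.+ n ≡ k → fromℕℚ m ≡ fromℕℚ k ℚ.- fromℕℚ n
fromℕℚ-∸ m n k eq = begin
  fromℕℚ m
    ≡⟨ solve 2 (λ p q → p := p :+ q :- q) refl (fromℕℚ m) (fromℕℚ n) ⟩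
  fromℕℚ m ℚ.+ fromℕℚ n ℚ.- fromℕℚ n
    ≡⟨ cong (ℚ._- fromℕℚ n) (trans (fromℕℚ-+ m n) (cong fromℕℚ eq)) ⟩
  fromℕℚ k ℚ.- fromℕℚ n
    ∎
  where open ℚ.+-*-Solver
        open ≡-Reasoning

-- Roots of the quadratic and their powers in ℝ.

^-step : ∀ t q γ → γ * γ ≈ t * γ + q → ∀ n →
  γ ^ suc (suc n) ≈ t * γ ^ suc n + q * γ ^ n
^-step t q γ γ²≈ n =
  ≈-trans factor (≈-trans (*-congˡ (γ ^ n) (γ * γ) (t * γ + q) γ²≈) distribute)
  where
  open ℚ.+-*-Solver

  factor : γ ^ suc (suc n) ≈ γ ^ n * (γ * γ)
  factor = ≗⇒≈ λ k → solve 2 (λ g p → g :* (g :* p) := p :* (g :* g)) refl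
    (seq γ k) (seq (γ ^ n) k)

  distribute : γ ^ n * (t * γ + q) ≈ t * γ ^ suc n + q * γ ^ n
  distribute = ≗⇒≈ λ k →
    solve 4 (λ g p t q → p :* (t :* g :+ q) := t :* (g :* p) :+ q :* p) refl
      (seq γ k) (seq (γ ^ n) k) (seq t k) (seq q k)

-- For arbitrary rational `s`, `γ²` exceeds `t γ + q` by a quarter of `s² − (t² + 4q)`. In ℝ that
-- difference vanishes only in the limit, so the `s²` term stands apart for `root-square` to
-- replace.
complete-square : ∀ t q s γ → γ ≡ (t ℚ.+ s) ℚ.* ½ →
  γ ℚ.* γ ≡ (t ℚ.* γ ℚ.+ q ℚ.- ½ ℚ.* ½ ℚ.* (t ℚ.* t ℚ.+ (ℤ.+ 4 ℚ./ 1) ℚ.* q))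
            ℚ.+ ½ ℚ.* ½ ℚ.* (s ℚ.* s)
complete-square t q s γ refl =
  solve 3 (λ t q s →
    let γ = (t :+ s) :* con ½
        D = t :* t :+ con (ℤ.+ 4 ℚ./ 1) :* q
    in γ :* γ := (t :* γ :+ q :- con (½ ℚ.* ½) :* D) :+ con (½ ℚ.* ½) :* (s :* s))
    refl t q s
  where open ℚ.+-*-Solver

-- The quadratic formula: (t ± √(t² + 4q)) / 2 are roots of γ² = t γ + q.
root-square : ∀ t q D s γ → seq D ≗ seq (t * t + fromℕ 4 * q) →
  seq γ ≗ seq ((t + s) / 2) → s * s ≈ D → γ * γ ≈ t * γ + q
root-square t q D s γ D≗ γ≗ s²≈D = ≈-trans isolate (≈-trans substitute cancel)
  where
  open ℚ.+-*-Solver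
  open ≡-Reasoning

  ¼ R : ℝ
  ¼ = fromℚ (½ ℚ.* ½)
  R = t * γ + q - ¼ * D

  isolate : γ * γ ≈ R + ¼ * (s * s)
  isolate = ≗⇒≈ λ n → begin
    seq γ n ℚ.* seq γ n
      ≡⟨ complete-square (seq t n) (seq q n) (seq s n) (seq γ n) (γ≗ n) ⟩
    (r n ℚ.- ½ ℚ.* ½ ℚ.* d n) ℚ.+ ½ ℚ.* ½ ℚ.* (seq s n ℚ.* seq s n)
      ≡⟨ cong (λ d → (r n ℚ.- ½ ℚ.* ½ ℚ.* d) ℚ.+ ½ ℚ.* ½ ℚ.* (seq s n ℚ.* seq s n)) (D≗ n) ⟨
    seq (R + ¼ * (s * s)) n
      ∎
    where
    r d : ℕ → ℚ
    r n = seq (t * γ + q) n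
    d n = seq (t * t + fromℕ 4 * q) n

  substitute : R + ¼ * (s * s) ≈ R + ¼ * D
  substitute = +-cong R R (¼ * (s * s)) (¼ * D) (≗⇒≈ λ _ → refl) (*-congˡ ¼ (s * s) D s²≈D)

  cancel : R + ¼ * D ≈ t * γ + q
  cancel = ≗⇒≈ λ n → solve 2 (λ p d → (p :- d) :+ d := p) refl
    (seq (t * γ + q) n) (seq (¼ * D) n)

-- `α^n + β^n` obeys the recurrence of `powerSum` by linearity, with the same initial values 2 and
-- `t`.
powerSum≈ : ∀ t q α β →
  α * α ≈ fromℚ t * α + fromℚ q → β * β ≈ fromℚ t * β + fromℚ q →
  (∀ k → seq α k ℚ.+ seq β k ≡ t) →
  ∀ n → fromℚ (powerSum t q n) ≈ α ^ n + β ^ n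
powerSum≈ t q α β α² β² α+β≡t = go
  where
  go : ∀ n → fromℚ (powerSum t q n) ≈ α ^ n + β ^ n
  go 0 = ≗⇒≈ λ _ → refl
  go 1 = ≗⇒≈ λ k → trans (sym (α+β≡t k))
    (sym (cong₂ ℚ._+_ (ℚ.*-identityʳ (seq α k)) (ℚ.*-identityʳ (seq β k))))
  go (suc (suc n)) =
    step (fromℚ t) (fromℚ q) (fromℚ (powerSum t q n)) (fromℚ (powerSum t q (suc n)))
      (≗⇒≈ λ _ → refl) (go n) (go (suc n))
      (^-step (fromℚ t) (fromℚ q) α α² n) (^-step (fromℚ t) (fromℚ q) β β² n)
    where
    step : ∀ t q p₀ p₁ {p₂} → p₂ ≈ t * p₁ + q * p₀ →
      p₀ ≈ α ^ n + β ^ n → p₁ ≈ α ^ suc n + β ^ suc n →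
      α ^ suc (suc n) ≈ t * α ^ suc n + q * α ^ n →
      β ^ suc (suc n) ≈ t * β ^ suc n + q * β ^ n →
      p₂ ≈ α ^ suc (suc n) + β ^ suc (suc n)
    step t q p₀ p₁ p₂≈ p₀≈ p₁≈ α^ β^ = ≈-trans p₂≈ (≈-trans
      (+-cong (t * p₁) (t * (α ^ suc n + β ^ suc n)) (q * p₀) (q * (α ^ n + β ^ n))
        (*-congˡ t p₁ (α ^ suc n + β ^ suc n) p₁≈) (*-congˡ q p₀ (α ^ n + β ^ n) p₀≈))
      (≈-trans regroup (≈-sym
        (+-cong (α ^ suc (suc n)) (t * α ^ suc n + q * α ^ n)
                (β ^ suc (suc n)) (t * β ^ suc n + q * β ^ n) α^ β^))))
      where
      open ℚ.+-*-Solver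
      regroup : t * (α ^ suc n + β ^ suc n) + q * (α ^ n + β ^ n)
                ≈ (t * α ^ suc n + q * α ^ n) + (t * β ^ suc n + q * β ^ n)
      regroup = ≗⇒≈ λ k →
        solve 6 (λ t q a b c d → t :* (a :+ b) :+ q :* (c :+ d)
                                 := (t :* a :+ q :* c) :+ (t :* b :+ q :* d)) refl
          (seq t k) (seq q k) (seq (α ^ suc n) k) (seq (β ^ suc n) k)
          (seq (α ^ n) k) (seq (β ^ n) k)

-- Alternating sign and nonnegative discriminant.

seq-sign : ∀ n k → seq ((- 1ℝ) ^ n) k ≡ sign n
seq-sign zero    k = refl
seq-sign (suc n) k = cong (ℚ.- 1ℚ ℚ.*_) (seq-sign n k)

0≤p² : ∀ p → 0ℚ ℚ.≤ p ℚ.* p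
0≤p² p = subst (0ℚ ℚ.≤_) (∣p∣² (ℚ.∣p∣≡p∨∣p∣≡-p p)) (0≤* (ℚ.0≤∣p∣ p) (ℚ.0≤∣p∣ p))
  where
  ∣p∣² : ∣ p ∣ ≡ p ⊎ ∣ p ∣ ≡ ℚ.- p → ∣ p ∣ ℚ.* ∣ p ∣ ≡ p ℚ.* p
  ∣p∣² (inj₁ eq) = cong₂ ℚ._*_ eq eq
  ∣p∣² (inj₂ eq) = trans (cong₂ ℚ._*_ eq eq)
    (solve 1 (λ p → (:- p) :* (:- p) := p :* p) refl p)
    where open ℚ.+-*-Solver

p≤q⇒0≤q-p : ∀ {p q} → p ℚ.≤ q → 0ℚ ℚ.≤ q ℚ.- p
p≤q⇒0≤q-p {p} {q} p≤q = subst (ℚ._≤ q ℚ.- p) (ℚ.+-inverseʳ p) (ℚ.+-monoˡ-≤ (ℚ.- p) p≤q)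

-- Supplies the hypothesis of `√-square`. With `q = x − y`, the condition `0 ≤ q` is `y ≤ x`.
discriminant-nonNeg : ∀ t q D → 0ℚ ℚ.≤ q → seq D ≗ seq (fromℚ t * fromℚ t + fromℕ 4 * fromℚ q) →
  0ℝ ≤ D
discriminant-nonNeg t q D 0≤q D≗ ε 0<ε = 0 , λ n _ → 0≤+
  (subst (0ℚ ℚ.≤_) (sym (D≗ n)) (0≤+ (0≤p² t) (0≤* (0≤/ 4 0) 0≤q)))
  (ℚ.<⇒≤ 0<ε)

-- From the count to the closed formula.

module _ (n : ℕ) (3≤n : 3 ≤ℕ n) (x y : ℕ) (y≤x : y ≤ℕ x) where

  private
    X Y t q : ℚ
    X = fromℕℚ x
    Y = fromℕℚ y
    t = X ℚ.- 1ℚ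
    q = X ℚ.- Y

  P≡powerSum : fromℕℚ (P (C n 3≤n) x y) ≡ powerSum t q n ℚ.+ sign n ℚ.* (Y ℚ.- 1ℚ)
  P≡powerSum = trans (cong fromℕℚ (P≡tr n 3≤n)) (formula n 3≤n)
    where
    open Counting.Walks x y

    formula : ∀ n → 3 ≤ℕ n → fromℕℚ (tr n) ≡ powerSum t q n ℚ.+ sign n ℚ.* (Y ℚ.- 1ℚ)
    -- The recurrences give traces of positive powers, hence the shift `tr ∘ suc`; `3 ≤ n` excludes
    -- `n = 0`.
    formula (suc n) _ = Recurrences.trace-formula X Y
      {fromℕℚ ∘ T} {fromℕℚ ∘ S} {fromℕℚ ∘ Δ} {fromℕℚ ∘ tr ∘ suc}
      (cong fromℕℚ T-zero) (cong fromℕℚ (S-zero y≤x)) (cong fromℕℚ (Δ-zero y≤x))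
      (λ n → subst (λ p → fromℕℚ (T (suc n)) ≡ p ℚ.- fromℕℚ (S n))
        (sym (fromℕℚ-* x (T n))) (fromℕℚ-∸ (T (suc n)) (S n) (x ℕ.* T n) (T-suc n)))
      (λ n → subst (λ p → fromℕℚ (S (suc n)) ≡ p ℚ.- fromℕℚ (S n))
        (sym (fromℕℚ-* y (T n))) (fromℕℚ-∸ (S (suc n)) (S n) (y ℕ.* T n) (S-suc y≤x n)))
      (λ n → fromℕℚ-∸ (Δ (suc n)) (Δ n) (S n) (Δ-suc n))
      (λ n → fromℕℚ-∸ (tr (suc n)) (Δ n) (T n) (tr-suc n))
      n

  -- The constituents of the formula are variables here because Agda decides
  -- equality of sums and products in ℝ by unfolding them together with their
  -- Cauchy proofs, which is infeasible for the concrete terms.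
  module _ (D s α β r : ℝ)
    (D≗ : seq D ≗ seq (fromℚ t * fromℚ t + fromℕ 4 * fromℚ q))
    (α≗ : seq α ≗ seq ((fromℚ t + - s) / 2))
    (β≗ : seq β ≗ seq ((fromℚ t + s) / 2))
    (r≗ : ∀ k → seq r k ≡ sign n ℚ.* (Y ℚ.- 1ℚ))
    (s²≃D : 0ℝ ≤ D → s * s ≃ D)
    where

    P≈roots : fromℕ (P (C n 3≤n) x y) ≈ α ^ n + β ^ n + r
    P≈roots = ≈-trans count (+-cong (fromℚ (powerSum t q n)) (α ^ n + β ^ n) r r
      (powerSum≈ t q α β α² β² α+β≡t n) (≗⇒≈ λ _ → refl))
      where
      open ℚ.+-*-Solver

      count : fromℕ (P (C n 3≤n) x y) ≈ fromℚ (powerSum t q n) + r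
      count = ≗⇒≈ λ k → trans P≡powerSum
        (cong (powerSum t q n ℚ.+_) (sym (r≗ k)))

      s² : s * s ≈ D
      s² = wrap (s²≃D
        (discriminant-nonNeg t q D (p≤q⇒0≤q-p {Y} {X} (fromℕℚ-mono y x y≤x)) D≗))

      -- `root-square` treats `(t + s) / 2`; the other root is its instance at `- s`, which has the
      -- same square.
      [-s]² : (- s) * (- s) ≈ s * s
      [-s]² = ≗⇒≈ λ k → solve 1 (λ s → (:- s) :* (:- s) := s :* s) refl (seq s k)

      α² : α * α ≈ fromℚ t * α + fromℚ q
      α² = root-square (fromℚ t) (fromℚ q) D (- s) α D≗ α≗ (≈-trans [-s]² s²)

      β² : β * β ≈ fromℚ t * β + fromℚ q
      β² = root-square (fromℚ t) (fromℚ q) D s β D≗ β≗ s²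

      α+β≡t : ∀ k → seq α k ℚ.+ seq β k ≡ t
      α+β≡t k = trans (cong₂ ℚ._+_ (α≗ k) (β≗ k))
        (solve 2 (λ t s → (t :+ :- s) :* con ½ :+ (t :+ s) :* con ½ := t) refl t (seq s k))

theorem2 : (n : ℕ) (3≤n : 3 ≤ℕ n) (x y : ℕ) → y ≤ℕ x →
    fromℕ (P (C n 3≤n) x y)
    ≃ ((fromℕ x - 1ℝ - √ ((fromℕ x + 1ℝ) ^ 2 - fromℕ 4 * fromℕ y)) / 2) ^ n
    + ((fromℕ x - 1ℝ + √ ((fromℕ x + 1ℝ) ^ 2 - fromℕ 4 * fromℕ y)) / 2) ^ n
    + (- 1ℝ) ^ n * (fromℕ y - 1ℝ)
theorem2 n 3≤n x y y≤x =
  let D = (fromℕ x + 1ℝ) ^ 2 - fromℕ 4 * fromℕ y in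
  unwrap (P≈roots n 3≤n x y y≤x D (√ D)
    ((fromℕ x - 1ℝ - √ D) / 2) ((fromℕ x - 1ℝ + √ D) / 2) ((- 1ℝ) ^ n * (fromℕ y - 1ℝ))
    (λ _ → discriminant (fromℕℚ x) (fromℕℚ y)) (λ _ → refl) (λ _ → refl)
    (λ k → cong (ℚ._* (fromℕℚ y ℚ.- 1ℚ)) (seq-sign n k)) (√-square D))
  where
  open ℚ.+-*-Solver

  -- Brings the radicand into the form `t² + 4q`. The extra factor `1ℚ` comes from unfolding the
  -- exponent 2.
  discriminant : ∀ x y → (x ℚ.+ 1ℚ) ℚ.* ((x ℚ.+ 1ℚ) ℚ.* 1ℚ) ℚ.- (ℤ.+ 4 ℚ./ 1) ℚ.* y
    ≡ (x ℚ.- 1ℚ) ℚ.* (x ℚ.- 1ℚ) ℚ.+ (ℤ.+ 4 ℚ./ 1) ℚ.* (x ℚ.- y)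
  discriminant = solve 2 (λ x y →
    (x :+ con 1ℚ) :* ((x :+ con 1ℚ) :* con 1ℚ) :- con (ℤ.+ 4 ℚ./ 1) :* y
    := (x :- con 1ℚ) :* (x :- con 1ℚ) :+ con (ℤ.+ 4 ℚ./ 1) :* (x :- y)) refl
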